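{- Let $m,n,k\ge0$. (a) For $K\subseteq[k-1]$, in $\mathsf{NSym}_{\mathbb C(q,t)}$, \[ \triangle\mathcal B(q,t)_{\mathrm{comp}(K)}=\sum_{\substack{m+n=k\\ I\subseteq[m-1],\ J\subseteq[n-1]}}C^K_{I,J}(q,t)\,\big(\mathcal B(q,t)_{\mathrm{comp}(I)}\otimes\mathcal B(q,t)_{\mathrm{comp}(J)}\big), \] \[ C^K_{I,J}(q,t)=t^{ -|I|-|J|}\sum_{\substack{A\in\binom{[m+n]}{n}:\ (I\#_AJ)\cap c(A)=\emptyset,\\ I\#_AJ\subseteq K\subseteq(I\#_AJ)\cup c(A)}}(q+t)^{|K\cap c_2(A)|}\,t^{|K\setminus c_2(A)|}. \] (b) For compositions $\alpha$ of $m$ and $\beta$ of $n$, $\mathcal B(q,t)_\alpha\,\mathcal B(q,t)_\beta=\mathcal B(q,t)_{\alpha\odot\beta}$.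
   Context: $[a,b]=\{t\in\mathbb Z:a\le t\le b\}$, $[n]=[1,n]$; $\binom{[N]}{n}$ = $n$-subsets of $[N]$. For $K=\{s_1<\dots<s_i\}\subseteq[n-1]$, $\mathrm{comp}(K)=(s_1,\dots,n-s_i)$, a composition of $n$. $\mathsf{NSym}_{\mathbb C(q,t)}$ is the Hopf algebra of noncommutative symmetric functions over the field $\mathbb C(q,t)$ ($q,t$ commuting indeterminates): free associative on $H_1,H_2,\dots$, $H_\alpha=H_{\alpha_1}\cdots H_{\alpha_l}$, coproduct $\triangle H_n=\sum_{i+j=n}H_i\otimes H_j$ ($H_0=1$). For $I\subseteq[n-1]$, $\mathcal B(q,t)_{\mathrm{comp}(I)}=\sum_{J\subseteq[n-1]:\,I\cup J=[n-1]}q^{|I\setminus J|}t^{|I\cap J|}H_{\mathrm{comp}(J)}$. For $A\subseteq[N]$: $\mathrm{conn}(A)$ = maximal subsets of consecutive integers of $A$; $c_1(A)=\{\max B:B\in\mathrm{conn}(A)\}\setminus\{N\}$, $c_2(A)=\{\max B:B\in\mathrm{conn}([N]\setminus A)\}\setminus\{N\}$, $c(A)=c_1(A)\cup c_2(A)$. For $A\in\binom{[m+n]}{n}$, $A^c=[m+n]\setminus A$, $I\subseteq[m-1]$, $J\subseteq[n-1]$: with $S_I=\{s_i:i\in I\}$ for $S=\{s_1<s_2<\cdots\}$, $I\#_AJ=(A^c)_I\cup A_J\subseteq[m+n-1]$. Near-concatenation: $(\alpha_1,\dots,\alpha_l)\odot(\beta_1,\dots,\beta_k)=(\alpha_1,\dots,\alpha_l+\beta_1,\beta_2,\dots,\beta_k)$,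 the empty composition acting as identity. -}

module Defs where

open import Level using (Level)
open import Algebra.Bundles using (CommutativeRing)
open import Data.Bool using (Bool; true; false; not; _∧_; _∨_; if_then_else_)
open import Data.Nat using (ℕ; zero; suc; _+_; _∸_; _⊔_; _≡ᵇ_; _≤_; pred)
import Data.Nat as ℕ
open import Data.List using (List; []; _∷_; _++_; map; concat; concatMap; foldr; length; filterᵇ; upTo)
open import Data.Nat.ListAction using (sum)
open import Data.Bool.ListAction using (all; any)
import Data.List.Properties as LP
open import Data.List.Relation.Unary.All using (All)
open import Data.Vec using (Vec; []; _∷_)
import Data.Vec.Properties as VP
import Data.Bool.Properties as BP
open import Data.Fin.Subset using (Subset; ∁; _∪_; _∩_; ⊤; ∣_∣)
open import Data.Product using (_×_; _,_)
open import Relation.Nullary.Decidable using (⌊_⌋)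

-- Finite sets of integers.
-- A subset of [N] = {1,…,N} is a 'Subset N' (Vec Bool N); bit number i
-- (0-based) says whether the integer i+1 belongs to the set.
-- A subset of [n-1] is a 'Subset (pred n)'  (for n = 0, [−1] = ∅).
-- Derived sets (c₁(A), I #_A J, …) are listed as List ℕ of elements.

allSubsets : (N : ℕ) → List (Subset N)
allSubsets zero    = [] ∷ []
allSubsets (suc N) = map (false ∷_) (allSubsets N) ++ map (true ∷_) (allSubsets N)

binom : (N n : ℕ) → List (Subset N)
binom N n = filterᵇ (λ A → ∣ A ∣ ≡ᵇ n) (allSubsets N)

elemsFrom : ∀ {N} → ℕ → Subset N → List ℕ
elemsFrom i []            = []
elemsFrom i (true  ∷ bs)  = i ∷ elemsFrom (suc i) bs
elemsFrom i (false ∷ bs)  = elemsFrom (suc i) bs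

elems : ∀ {N} → Subset N → List ℕ
elems = elemsFrom 1

_∈ᵇ_ : ℕ → List ℕ → Bool
x ∈ᵇ xs = any (x ≡ᵇ_) xs

-- S_i = i-th smallest element (1-indexed) of an increasing list S
nth : List ℕ → ℕ → ℕ
nth []       _             = 0
nth (x ∷ xs) zero          = 0
nth (x ∷ xs) (suc zero)    = x
nth (x ∷ xs) (suc (suc i)) = nth xs (suc i)

-- comp(K) for K ⊆ [n-1]: the composition of n with partial sums K
compGo : ∀ {k} → Vec Bool k → ℕ → List ℕ
compGo []           c = c ∷ []
compGo (true  ∷ bs) c = c ∷ compGo bs 1
compGo (false ∷ bs) c = compGo bs (suc c)

comp : (n : ℕ) → Subset (pred n) → List ℕ
comp zero    K = []
comp (suc n) K = compGo K 1

-- conn(A): maximal runs of consecutive integers of A ⊆ [N]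
closeBlock : List ℕ → List (List ℕ) → List (List ℕ)
closeBlock []        r = r
closeBlock (x ∷ cur) r = (x ∷ cur) ∷ r

blocksAux : ∀ {N} → ℕ → List ℕ → Vec Bool N → List (List ℕ)
blocksAux i cur []           = closeBlock cur []
blocksAux i cur (true  ∷ bs) = blocksAux (suc i) (cur ++ (i ∷ [])) bs
blocksAux i cur (false ∷ bs) = closeBlock cur (blocksAux (suc i) [] bs)

conn : ∀ {N} → Subset N → List (List ℕ)
conn A = blocksAux 1 [] A

maxL : List ℕ → ℕ
maxL = foldr _⊔_ 0

c₁ : ∀ {N} → Subset N → List ℕ
c₁ {N} A = filterᵇ (λ x → not (x ≡ᵇ N)) (map maxL (conn A))

c₂ : ∀ {N} → Subset N → List ℕ
c₂ A = c₁ (∁ A)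

cset : ∀ {N} → Subset N → List ℕ
cset A = c₁ A ++ c₂ A

-- I #_A J = (A^c)_I ∪ A_J   (A ⊆ [m+n], I ⊆ [m-1], J ⊆ [n-1])
sharp : ∀ {N m n} → Subset N → Subset m → Subset n → List ℕ
sharp A I J = map (nth (elems (∁ A))) (elems I) ++ map (nth (elems A)) (elems J)

_⊙_ : List ℕ → List ℕ → List ℕ
[]               ⊙ β       = β
(a ∷ [])         ⊙ []      = a ∷ []
(a ∷ [])         ⊙ (b ∷ β) = (a + b) ∷ β
(a ∷ a′ ∷ α)     ⊙ β       = a ∷ ((a′ ∷ α) ⊙ β)

IsComposition : List ℕ → Set
IsComposition α = All (λ a → 1 ≤ a) α

-- NSym over a commutative ring R, realised as the free R-module on the
-- basis {H_α}, α a composition; elements are finite formal sums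
-- (lists of (coefficient, α)), compared coefficientwise.
-- NSym ⊗ NSym is the free R-module on the basis {H_α ⊗ H_β}.

module NSym {c ℓ : Level} (R : CommutativeRing c ℓ) where
  open CommutativeRing R renaming (_+_ to _+R_; _*_ to _*R_)

  pow : Carrier → ℕ → Carrier
  pow x zero    = 1#
  pow x (suc n) = x *R pow x n

  sumR : List Carrier → Carrier
  sumR = foldr _+R_ 0#

  Comp : Set
  Comp = List ℕ

  NS : Set c
  NS = List (Carrier × Comp)

  NS² : Set c
  NS² = List (Carrier × (Comp × Comp))

  _≟C_ : (α β : Comp) → _
  _≟C_ = LP.≡-dec ℕ._≟_

  coeff : NS → Comp → Carrier
  coeff x α = foldr (λ { (r , β) acc → if ⌊ β ≟C α ⌋ then r +R acc else acc }) 0# x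

  coeff² : NS² → Comp → Comp → Carrier
  coeff² x α β =
    foldr (λ { (r , (α′ , β′)) acc → if ⌊ α′ ≟C α ⌋ ∧ ⌊ β′ ≟C β ⌋ then r +R acc else acc }) 0# x

  _≋_ : NS → NS → Set ℓ
  x ≋ y = ∀ α → coeff x α ≈ coeff y α

  _≋²_ : NS² → NS² → Set ℓ
  x ≋² y = ∀ α β → coeff² x α β ≈ coeff² y α β

  -- the basis element H_α  (H_0 = 1: zero parts are dropped)
  H : Comp → NS
  H α = (1# , filterᵇ (λ a → not (a ≡ᵇ 0)) α) ∷ []

  scale : Carrier → NS → NS
  scale r = map (λ { (s , α) → (r *R s , α) })

  scale² : Carrier → NS² → NS²
  scale² r = map (λ { (s , αβ) → (r *R s , αβ) })

  _·_ : NS → NS → NS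
  x · y = concatMap (λ { (r , α) → map (λ { (s , β) → (r *R s , α ++ β) }) y }) x

  _⊗_ : NS → NS → NS²
  x ⊗ y = concatMap (λ { (r , α) → map (λ { (s , β) → (r *R s , (α , β)) }) y }) x

  _·²_ : NS² → NS² → NS²
  x ·² y = concatMap (λ { (r , (α , β)) →
             map (λ { (s , (α′ , β′)) → (r *R s , (α ++ α′ , β ++ β′)) }) y }) x

  △gen : ℕ → NS²
  △gen a = concatMap (λ i → H (i ∷ []) ⊗ H ((a ∸ i) ∷ [])) (upTo (suc a))

  -- △ H_α = △H_{α₁} ⋯ △H_{α_l}   (△ is an algebra morphism)
  △H : Comp → NS²
  △H []      = (1# , ([] , [])) ∷ []
  △H (a ∷ α) = △gen a ·² △H α

  △ : NS → NS²
  △ x = concatMap (λ { (r , α) → scale² r (△H α) }) x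

  Bset : (q t : Carrier) (n : ℕ) → Subset (pred n) → NS
  Bset q t n I =
    concatMap (λ J → scale (pow q ∣ I ∩ ∁ J ∣ *R pow t ∣ I ∩ J ∣) (H (comp n J)))
      (filterᵇ (λ J → ⌊ VP.≡-dec BP._≟_ (I ∪ J) ⊤ ⌋) (allSubsets (pred n)))

  -- B(q,t)_α for a composition α: B(q,t)_{comp(I)} for the (unique) I with comp(I) = α
  B : (q t : Carrier) → Comp → NS
  B q t α =
    concatMap (Bset q t (sum α))
      (filterᵇ (λ I → ⌊ comp (sum α) I ≟C α ⌋) (allSubsets (pred (sum α))))

  -- C^K_{I,J}(q,t), with tinv = t⁻¹; K given by its list of elements
  Ccoef : (q t tinv : Carrier) (m n : ℕ) → List ℕ →
          Subset (pred m) → Subset (pred n) → Carrier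
  Ccoef q t tinv m n K I J =
    pow tinv (∣ I ∣ ℕ.+ ∣ J ∣) *R
    sumR (map term (filterᵇ cond (binom (m ℕ.+ n) n)))
    where
      cond : Subset (m ℕ.+ n) → Bool
      cond A =
        all (λ x → not (x ∈ᵇ cset A)) (sharp A I J) ∧
        all (λ x → x ∈ᵇ K) (sharp A I J) ∧
        all (λ x → (x ∈ᵇ sharp A I J) ∨ (x ∈ᵇ cset A)) K
      term : Subset (m ℕ.+ n) → Carrier
      term A = pow (q +R t) (length (filterᵇ (λ x → x ∈ᵇ c₂ A) K)) *R
               pow t (length (filterᵇ (λ x → not (x ∈ᵇ c₂ A)) K))

  RHS : (q t tinv : Carrier) (k : ℕ) → Subset (pred k) → NS²
  RHS q t tinv k K =
    concatMap (λ m →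
      concatMap (λ I →
        concatMap (λ J →
          scale² (Ccoef q t tinv m (k ∸ m) (elems K) I J)
                 (Bset q t m I ⊗ Bset q t (k ∸ m) J))
          (allSubsets (pred (k ∸ m))))
        (allSubsets (pred m)))
      (upTo (suc k))

{-# OPTIONS --safe #-}
module Submission where

-- Expanding B(q,t)_K cuts a row of k cells: a gap outside K is always cut, a gap in K is merged with
-- weight q or cut with weight t. The coproduct splits every block into cells outside a set A followed
-- by cells inside A, so △ B(q,t)_K is a sum over words A. A gap of K between equal letters is merged (q)
-- or cut (t); at an ascent 01, i.e. in c₂(A), both choices give the same tensor, so the weight is q + t;
-- at a descent 10, i.e. in c₁(A), only the cut survives, with weight t. Collecting the terms for
-- fixed A gives B_I ⊗ B_J, where I and J record the gaps of K inside the runs of Aᶜ and A. These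
-- are the only I, J that satisfy the condition defining C^K_{I,J}.

open import Defs
open import Level using (Level)
open import Algebra.Bundles using (CommutativeRing)
open import Data.Bool using (Bool; true; false; not; _∧_; _∨_; if_then_else_)
open import Data.Bool.ListAction using (all)
import Data.Bool.Properties as BP
open import Data.Fin using (zero; suc; toℕ)
open import Data.Fin.Subset using (Subset; ∁; _∩_; _∪_; ∣_∣; ⊤)
import Data.Fin.Subset.Properties as SP
open import Data.List as List using (List; []; _∷_; _++_; filterᵇ; length; concatMap; upTo)
import Data.List.Properties as LP
open import Data.List.Relation.Unary.All using ([]; _∷_)
open import Data.Nat as ℕ using (ℕ; zero; suc; _∸_; _⊔_; _≡ᵇ_; _≤_; _<_; pred; s≤s)
import Data.Nat.Properties as NP
open import Data.Nat.ListAction using (sum)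
open import Data.Product using (_×_; _,_; proj₁; proj₂; ∃; ∃₂)
open import Data.Vec as Vec using (Vec; []; _∷_; lookup; toList)
import Data.Vec.Properties as VP
open import Function.Base using (_∘_)
open import Function.Bundles using (_⇔_; mk⇔; Equivalence)
open import Relation.Binary.PropositionalEquality as ≡ using (_≡_; _≢_)
open import Relation.Nullary.Decidable using (⌊_⌋; yes; no; does; isYes≗does; dec-true; dec-false)
open import Relation.Nullary.Negation using (contradiction)

open Equivalence using (to; from)

-- Merging or cutting a gap changes the current block, while the next letter decides which tensor
-- factor the next cell enters. A gapwise comparison therefore closes only with both the size of the
-- unfinished block and the last letter as state. The recursion `words` carries this state and
-- stands between the two sides: the coproduct reduces to it by splitting blocks, the right-hand
-- side by summing over A. The factor t^(-|I|-|J|) corrects a double count: the power of t in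
-- C^K_{I,J} also counts the |I| + |J| gaps of K inside runs, which B_I ⊗ B_J already weights by q
-- or t. Part (b) rests on a duality: a gap outside I is merged in comp(I) but cut in every
-- H_comp(J) occurring in B_I, so concatenating the H's near-concatenates the indices.

-- A word A = p ∷ X has one bit per cell 1, …, N. Subsets of [N - 1] are read as sets of gaps, gap i lying
-- between the cells i and i + 1; shift p X is the left and X the right neighbour of each gap.
shift : ∀ {n} → Bool → Vec Bool n → Vec Bool n
shift p []      = []
shift p (a ∷ X) = p ∷ shift a X

runGaps : ∀ {n} → Bool → Vec Bool n → Vec Bool n → Vec Bool n
runGaps p X K = shift p X ∩ (X ∩ K)

runEnds : ∀ {n} → Bool → Vec Bool n → Vec Bool n
runEnds p X = shift p X ∩ ∁ X

-- One bit for each element of X: whether it is joined to its predecessor by a gap in K.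
joins : ∀ {n} → Bool → Vec Bool n → Vec Bool n → List Bool
joins p []          []      = []
joins p (true  ∷ X) (k ∷ K) = (p ∧ k) ∷ joins true X K
joins p (false ∷ X) (k ∷ K) = joins false X K

-- The first cell has no gap before it; an imaginary letter and gap `false` stand in. The first
-- element of the set thus gets the bit `false`, and `List.drop 1` leaves one bit for each pair of
-- successive elements, as for a subset of [r - 1] when the set has r elements.
joinsFrom : ∀ {n} → Bool → Vec Bool n → Vec Bool n → List Bool
joinsFrom p X K = joins false (p ∷ X) (false ∷ K)

length-joins : ∀ {n} p (X K : Vec Bool n) → length (joins p X K) ≡ ∣ X ∣
length-joins p []          []      = ≡.refl
length-joins p (true  ∷ X) (k ∷ K) = ≡.cong suc (length-joins true X K)
length-joins p (false ∷ X) (k ∷ K) = length-joins false X K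

-- The characteristic vector, by gaps, of S_I for S = p ∷ X.
spread : ∀ {n j} → Bool → Vec Bool n → Vec Bool j → Vec Bool n
spread p     []      I       = []
spread true  (a ∷ X) []      = false ∷ spread a X []
spread true  (a ∷ X) (b ∷ I) = b ∷ spread a X I
spread false (a ∷ X) I       = false ∷ spread a X I

spread-⊆-shift : ∀ {n j} p (X : Vec Bool n) (I : Vec Bool j) i →
  lookup (spread p X I) i ≡ true → lookup (shift p X) i ≡ true
spread-⊆-shift true  (a ∷ X) []      zero    ()
spread-⊆-shift true  (a ∷ X) []      (suc i) e = spread-⊆-shift a X [] i e
spread-⊆-shift true  (a ∷ X) (b ∷ I) zero    e = ≡.refl
spread-⊆-shift true  (a ∷ X) (b ∷ I) (suc i) e = spread-⊆-shift a X I i e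
spread-⊆-shift false (a ∷ X) I       zero    ()
spread-⊆-shift false (a ∷ X) I       (suc i) e = spread-⊆-shift a X I i e

elemsFrom-spread-[] : ∀ {n} s p (X : Vec Bool n) → elemsFrom s (spread p X []) ≡ []
elemsFrom-spread-[] s p     []      = ≡.refl
elemsFrom-spread-[] s true  (a ∷ X) = elemsFrom-spread-[] (suc s) a X
elemsFrom-spread-[] s false (a ∷ X) = elemsFrom-spread-[] (suc s) a X

map-nth-∷ : ∀ {j} x xs s (I : Vec Bool j) →
  List.map (nth (x ∷ xs)) (elemsFrom (suc (suc s)) I) ≡ List.map (nth xs) (elemsFrom (suc s) I)
map-nth-∷ x xs s []          = ≡.refl
map-nth-∷ x xs s (true  ∷ I) = ≡.cong (nth xs (suc s) ∷_) (map-nth-∷ x xs (suc s) I)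
map-nth-∷ x xs s (false ∷ I) = map-nth-∷ x xs (suc s) I

-- One bit of I is spent at each element of S. The length hypothesis keeps I from outlasting the
-- gaps; the last element of S gets no bit.
select-spread : ∀ {n j} s p (X : Vec Bool n) (I : Vec Bool j) → j ≡ pred ∣ p ∷ X ∣ →
  List.map (nth (elemsFrom s (p ∷ X))) (elemsFrom 1 I) ≡ elemsFrom s (spread p X I)
select-spread s false []      []      e = ≡.refl
select-spread s true  []      []      e = ≡.refl
select-spread s false (a ∷ X) I       e = select-spread (suc s) a X I e
select-spread s true  (a ∷ X) []      e = ≡.sym (elemsFrom-spread-[] (suc s) a X)
select-spread s true  (a ∷ X) (true ∷ I) e =
  ≡.cong (s ∷_) (≡.trans (map-nth-∷ s (elemsFrom (suc s) (a ∷ X)) 0 I) (select-spread (suc s) a X I (≡.cong pred e)))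
select-spread s true  (a ∷ X) (false ∷ I) e =
  ≡.trans (map-nth-∷ s (elemsFrom (suc s) (a ∷ X)) 0 I) (select-spread (suc s) a X I (≡.cong pred e))

∷-⇔ : ∀ {n} {b c : Bool} {U V : Vec Bool n} {xs ys : List Bool} → (U ≡ V) ⇔ (xs ≡ ys) →
  ((b ∷ U) ≡ (c ∷ V)) ⇔ ((b ∷ xs) ≡ (c ∷ ys))
∷-⇔ e = mk⇔ (λ { ≡.refl → ≡.cong (_ ∷_) (to e ≡.refl) })
            (λ { ≡.refl → ≡.cong (_ ∷_) (from e ≡.refl) })

∷ᵛ-⇔ : ∀ {n} {b : Bool} {U V : Vec Bool n} {xs ys : List Bool} → (U ≡ V) ⇔ (xs ≡ ys) →
  ((b ∷ U) ≡ (b ∷ V)) ⇔ (xs ≡ ys)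
∷ᵛ-⇔ e = mk⇔ (λ { ≡.refl → to e ≡.refl }) (λ h → ≡.cong (_ ∷_) (from e h))

-- The letter before the first element of X is outside X, so that element is joined to nothing.
joins-false : ∀ {n j} (X K : Vec Bool n) → suc j ≡ ∣ X ∣ →
  joins false X K ≡ false ∷ List.drop 1 (joins false X K)
joins-false (true  ∷ X) (k ∷ K) e = ≡.refl
joins-false (false ∷ X) (k ∷ K) e = joins-false X K e

joins-empty : ∀ {n} p (X K : Vec Bool n) → 0 ≡ ∣ X ∣ → joins p X K ≡ []
joins-empty p X K e with joins p X K | length-joins p X K
... | []    | _ = ≡.refl
... | _ ∷ _ | h with ≡.trans h (≡.sym e)
... | ()

-- `spread` spends a bit of I at the left end of a gap, `joins` emits one at its right end, hence
-- `List.drop 1`. Where an element is followed by a cell outside the set, `runGaps` asks for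
-- `false`, which is what `joins` emits at the next element of the set, if there is one.
spread≡runGaps⇔ : ∀ {n j} p (X K : Vec Bool n) (I : Vec Bool j) → j ≡ pred ∣ p ∷ X ∣ →
  (spread p X I ≡ runGaps p X K) ⇔ (toList I ≡ List.drop 1 (joinsFrom p X K))
spread≡runGaps⇔ true  []          []      [] e = mk⇔ (λ _ → ≡.refl) (λ _ → ≡.refl)
spread≡runGaps⇔ false []          []      [] e = mk⇔ (λ _ → ≡.refl) (λ _ → ≡.refl)
spread≡runGaps⇔ false (true  ∷ X) (k ∷ K) I e = ∷ᵛ-⇔ (spread≡runGaps⇔ true X K I e)
spread≡runGaps⇔ false (false ∷ X) (k ∷ K) I e = ∷ᵛ-⇔ (spread≡runGaps⇔ false X K I e)
spread≡runGaps⇔ true  (true  ∷ X) (k ∷ K) (b ∷ I) e = ∷-⇔ (spread≡runGaps⇔ true X K I (≡.cong pred e))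
spread≡runGaps⇔ true  (false ∷ X) (k ∷ K) [] e
  rewrite joins-empty false X K e = ∷ᵛ-⇔ (≡.subst (λ l → (spread false X [] ≡ runGaps false X K) ⇔ ([] ≡ List.drop 1 l))
            (joins-empty false X K e) (spread≡runGaps⇔ false X K [] (≡.cong pred e)))
spread≡runGaps⇔ true  (false ∷ X) (k ∷ K) (b ∷ I) e
  rewrite joins-false X K e = ∷-⇔ (spread≡runGaps⇔ false X K I (≡.cong pred e))

-- The sets c₁(A) and c₂(A) as sets of gaps

maxL-++ : ∀ xs ys → maxL (xs ++ ys) ≡ maxL xs ⊔ maxL ys
maxL-++ []       ys = ≡.refl
maxL-++ (x ∷ xs) ys = ≡.trans (≡.cong (x ⊔_) (maxL-++ xs ys)) (≡.sym (NP.⊔-assoc x (maxL xs) (maxL ys)))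

≡ᵇ-refl : ∀ n → (n ≡ᵇ n) ≡ true
≡ᵇ-refl zero    = ≡.refl
≡ᵇ-refl (suc n) = ≡ᵇ-refl n

<⇒≢ᵇ : ∀ {m n} → m < n → (m ≡ᵇ n) ≡ false
<⇒≢ᵇ {zero}  (s≤s _) = ≡.refl
<⇒≢ᵇ {suc m} (s≤s h) = <⇒≢ᵇ h

>⇒≢ᵇ : ∀ {m n} → n < m → (m ≡ᵇ n) ≡ false
>⇒≢ᵇ {suc m} {zero}  _       = ≡.refl
>⇒≢ᵇ {suc m} {suc n} (s≤s h) = >⇒≢ᵇ h

blockEnds : ∀ {n} → ℕ → ℕ → List ℕ → Vec Bool n → List ℕ
blockEnds N i cur X = filterᵇ (λ x → not (x ≡ᵇ N)) (List.map maxL (blocksAux i cur X))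

maxL-snoc : ∀ i cur → maxL cur ≡ i → maxL (cur ++ suc i ∷ []) ≡ suc i
maxL-snoc i cur e rewrite maxL-++ cur (suc i ∷ []) | e = NP.m≤n⇒m⊔n≡n (NP.n≤1+n i)

mutual
  blockEnds-outside : ∀ {n} N i (X : Vec Bool n) → N ≡ i ℕ.+ n →
    blockEnds N (suc i) [] X ≡ elemsFrom i (runEnds false X)
  blockEnds-outside N i []          e = ≡.refl
  blockEnds-outside {suc n} N i (true ∷ X) e =
    blockEnds-inside N (suc i) (suc i) [] X (≡.trans e (NP.+-suc i n)) ≡.refl
  blockEnds-outside {suc n} N i (false ∷ X) e =
    blockEnds-outside N (suc i) X (≡.trans e (NP.+-suc i n))

  -- The block in hand ends at the last cell read, i. If the word ends here too, then i = N and the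
  -- filter of `c₁` drops it, just as there is no gap after the last cell.
  blockEnds-inside : ∀ {n} N i x cur (X : Vec Bool n) → N ≡ i ℕ.+ n → maxL (x ∷ cur) ≡ i →
    blockEnds N (suc i) (x ∷ cur) X ≡ elemsFrom i (runEnds true X)
  blockEnds-inside N i x cur [] e m rewrite m | e | NP.+-identityʳ i | ≡ᵇ-refl i = ≡.refl
  blockEnds-inside {suc n} N i x cur (true ∷ X) e m =
    blockEnds-inside N (suc i) x (cur ++ suc i ∷ []) X (≡.trans e (NP.+-suc i n)) (maxL-snoc i (x ∷ cur) m)
  blockEnds-inside {suc n} N i x cur (false ∷ X) e m
    rewrite m | <⇒≢ᵇ {i} {N} (≡.subst (i <_) (≡.sym (≡.trans e (NP.+-suc i n))) (s≤s (NP.m≤m+n i n))) =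
    ≡.cong (i ∷_) (blockEnds-outside N (suc i) X (≡.trans e (NP.+-suc i n)))

c₁-elems : ∀ {n} a (X : Vec Bool n) → c₁ (a ∷ X) ≡ elems (runEnds a X)
c₁-elems {n} true  X = blockEnds-inside (suc n) 1 1 [] X ≡.refl ≡.refl
c₁-elems {n} false X = blockEnds-outside (suc n) 1 X ≡.refl

-- The condition on A, gap by gap

∈ᵇ-++ : ∀ x xs ys → (x ∈ᵇ (xs ++ ys)) ≡ (x ∈ᵇ xs) ∨ (x ∈ᵇ ys)
∈ᵇ-++ x []       ys = ≡.refl
∈ᵇ-++ x (y ∷ xs) ys rewrite ∈ᵇ-++ x xs ys = ≡.sym (BP.∨-assoc (x ≡ᵇ y) _ _)

∉ᵇ-elemsFrom : ∀ {n} x s (V : Vec Bool n) → x < s → (x ∈ᵇ elemsFrom s V) ≡ false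
∉ᵇ-elemsFrom x s []          h = ≡.refl
∉ᵇ-elemsFrom x s (true  ∷ V) h rewrite <⇒≢ᵇ h = ∉ᵇ-elemsFrom x (suc s) V (NP.m<n⇒m<1+n h)
∉ᵇ-elemsFrom x s (false ∷ V) h = ∉ᵇ-elemsFrom x (suc s) V (NP.m<n⇒m<1+n h)

∈ᵇ-elemsFrom : ∀ {n} s (V : Vec Bool n) i → ((s ℕ.+ toℕ i) ∈ᵇ elemsFrom s V) ≡ lookup V i
∈ᵇ-elemsFrom s (true ∷ V) zero rewrite NP.+-identityʳ s | ≡ᵇ-refl s = ≡.refl
∈ᵇ-elemsFrom s (false ∷ V) zero rewrite NP.+-identityʳ s = ∉ᵇ-elemsFrom s (suc s) V NP.≤-refl
∈ᵇ-elemsFrom s (true ∷ V) (suc i)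
  rewrite NP.+-suc s (toℕ i) | >⇒≢ᵇ {suc s ℕ.+ toℕ i} {s} (s≤s (NP.m≤m+n s (toℕ i))) = ∈ᵇ-elemsFrom (suc s) V i
∈ᵇ-elemsFrom s (false ∷ V) (suc i) rewrite NP.+-suc s (toℕ i) = ∈ᵇ-elemsFrom (suc s) V i

∈ᵇ-elems : ∀ {n} (V : Vec Bool n) i → (suc (toℕ i) ∈ᵇ elems V) ≡ lookup V i
∈ᵇ-elems = ∈ᵇ-elemsFrom 1

∈ᵇ-elems-++ : ∀ {n} (U V : Vec Bool n) i →
  (suc (toℕ i) ∈ᵇ (elems U ++ elems V)) ≡ lookup U i ∨ lookup V i
∈ᵇ-elems-++ U V i = ≡.trans (∈ᵇ-++ (suc (toℕ i)) (elems U) (elems V)) (≡.cong₂ _∨_ (∈ᵇ-elems U i) (∈ᵇ-elems V i))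

∧-true⇔ : ∀ {a b} → (a ∧ b ≡ true) ⇔ (a ≡ true × b ≡ true)
∧-true⇔ {true}  = mk⇔ (λ e → ≡.refl , e) proj₂
∧-true⇔ {false} = mk⇔ (λ ()) (λ ())

all-elemsFrom : ∀ {n} (p : ℕ → Bool) s (V : Vec Bool n) →
  (all p (elemsFrom s V) ≡ true) ⇔ (∀ i → lookup V i ≡ true → p (s ℕ.+ toℕ i) ≡ true)
all-elemsFrom p s V = mk⇔ (⇒ s V) (⇐ s V)
  where
  ⇒ : ∀ {n} s (V : Vec Bool n) → all p (elemsFrom s V) ≡ true → ∀ i → lookup V i ≡ true → p (s ℕ.+ toℕ i) ≡ true
  ⇒ s (true ∷ V) h zero    e rewrite NP.+-identityʳ s = proj₁ (to ∧-true⇔ h)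
  ⇒ s (true ∷ V) h (suc i) e rewrite NP.+-suc s (toℕ i) = ⇒ (suc s) V (proj₂ (to (∧-true⇔ {p s}) h)) i e
  ⇒ s (false ∷ V) h (suc i) e rewrite NP.+-suc s (toℕ i) = ⇒ (suc s) V h i e
  ⇐ : ∀ {n} s (V : Vec Bool n) → (∀ i → lookup V i ≡ true → p (s ℕ.+ toℕ i) ≡ true) → all p (elemsFrom s V) ≡ true
  ⇐ s []          h = ≡.refl
  ⇐ s (true ∷ V)  h = from ∧-true⇔ (≡.subst (λ x → p x ≡ true) (NP.+-identityʳ s) (h zero ≡.refl) ,
    ⇐ (suc s) V (λ i e → ≡.subst (λ x → p x ≡ true) (NP.+-suc s (toℕ i)) (h (suc i) e)))
  ⇐ s (false ∷ V) h =
    ⇐ (suc s) V (λ i e → ≡.subst (λ x → p x ≡ true) (NP.+-suc s (toℕ i)) (h (suc i) e))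

all-++ : ∀ (p : ℕ → Bool) xs ys → all p (xs ++ ys) ≡ all p xs ∧ all p ys
all-++ p []       ys = ≡.refl
all-++ p (x ∷ xs) ys rewrite all-++ p xs ys = ≡.sym (BP.∧-assoc (p x) _ _)

∨-true⇒ : ∀ {a b} {C : Set} → (a ≡ true → C) → (b ≡ true → C) → a ∨ b ≡ true → C
∨-true⇒ {true}  f g e = f e
∨-true⇒ {false} f g e = g e

∨-trueˡ : ∀ {a} b → a ≡ true → a ∨ b ≡ true
∨-trueˡ b ≡.refl = ≡.refl

∨-trueʳ : ∀ a {b} → b ≡ true → a ∨ b ≡ true
∨-trueʳ a ≡.refl = BP.∨-zeroʳ a

all-elems-++ : ∀ {n} (p : ℕ → Bool) (U V : Vec Bool n) →
  (all p (elems U ++ elems V) ≡ true) ⇔ (∀ i → lookup U i ∨ lookup V i ≡ true → p (suc (toℕ i)) ≡ true)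
all-elems-++ p U V = mk⇔
  (λ h i → let h′ = to (∧-true⇔ {all p (elems U)}) (≡.trans (≡.sym (all-++ p (elems U) (elems V))) h) in
     ∨-true⇒ (to (all-elemsFrom p 1 U) (proj₁ h′) i) (to (all-elemsFrom p 1 V) (proj₂ h′) i))
  (λ h → ≡.trans (all-++ p (elems U) (elems V)) (from ∧-true⇔
     ( from (all-elemsFrom p 1 U) (λ i e → h i (∨-trueˡ _ e))
     , from (all-elemsFrom p 1 V) (λ i e → h i (∨-trueʳ (lookup U i) e)))))

-- The condition on A in C^K_{I,J}, with S = I #_A J, C = c(A) and L = K.
admissible : List ℕ → List ℕ → List ℕ → Bool
admissible S C L =
  all (λ x → not (x ∈ᵇ C)) S ∧
  all (λ x → x ∈ᵇ L) S ∧
  all (λ x → (x ∈ᵇ S) ∨ (x ∈ᵇ C)) L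

-- At one gap, u and v are its bits in the two parts of I #_A J, c and d those in c₁(A) and c₂(A), k
-- that in K.
GapAdmissible : (u v c d k : Bool) → Set
GapAdmissible u v c d k =
  (u ∨ v ≡ true → not (c ∨ d) ≡ true) × (u ∨ v ≡ true → k ≡ true) × (k ≡ true → (u ∨ v) ∨ (c ∨ d) ≡ true)

admissible⇔ : ∀ {n} (U V C D K : Vec Bool n) →
  (admissible (elems U ++ elems V) (elems C ++ elems D) (elems K) ≡ true) ⇔
  (∀ i → GapAdmissible (lookup U i) (lookup V i) (lookup C i) (lookup D i) (lookup K i))
admissible⇔ U V C D K = mk⇔
  (λ h → let h₁ , h₂₃ = to ∧-true⇔ h
             h₂ , h₃ = to ∧-true⇔ h₂₃ in λ i →
     (λ e → ≡.trans (≡.cong not (≡.sym (∈ᵇ-elems-++ C D i))) (to (all-elems-++ _ U V) h₁ i e)) ,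
     (λ e → ≡.trans (≡.sym (∈ᵇ-elems K i)) (to (all-elems-++ _ U V) h₂ i e)) ,
     (λ e → ≡.trans (≡.cong₂ _∨_ (≡.sym (∈ᵇ-elems-++ U V i)) (≡.sym (∈ᵇ-elems-++ C D i))) (to (all-elemsFrom _ 1 K) h₃ i e)))
  (λ h → from ∧-true⇔
    ( from (all-elems-++ _ U V) (λ i e → ≡.trans (≡.cong not (∈ᵇ-elems-++ C D i)) (proj₁ (h i) e))
    , from ∧-true⇔
      ( from (all-elems-++ _ U V) (λ i e → ≡.trans (∈ᵇ-elems K i) (proj₁ (proj₂ (h i)) e))
      , from (all-elemsFrom _ 1 K) (λ i e →
          ≡.trans (≡.cong₂ _∨_ (∈ᵇ-elems-++ U V i) (∈ᵇ-elems-++ C D i)) (proj₂ (proj₂ (h i)) e)))))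

-- Here p and a are the letters left and right of the gap. If they differ, the gap lies in c(A) and
-- the first clause makes u and v vanish. If they agree, it does not, the other two clauses give u ∨
-- v = k, and the support hypotheses decide which of u and v carries it.
gapAdmissible⇔ : ∀ p a k u v → (u ≡ true → not p ≡ true) → (v ≡ true → p ≡ true) →
  GapAdmissible u v (p ∧ not a) (not p ∧ not (not a)) k ⇔
  (u ≡ not p ∧ (not a ∧ k) × v ≡ p ∧ (a ∧ k))
gapAdmissible⇔ p a k u v hu hv = mk⇔ (⇒ p a k u v hu hv) (⇐ p a k u v)
  where
  ⇒ : ∀ p a k u v → (u ≡ true → not p ≡ true) → (v ≡ true → p ≡ true) →
    GapAdmissible u v (p ∧ not a) (not p ∧ not (not a)) k →
    u ≡ not p ∧ (not a ∧ k) × v ≡ p ∧ (a ∧ k)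
  ⇒ true  a     k     true  v     hu hv g = contradiction (hu ≡.refl) λ ()
  ⇒ false a     k     u     true  hu hv g = contradiction (hv ≡.refl) λ ()
  ⇒ true  true  true  false true  hu hv g = ≡.refl , ≡.refl
  ⇒ true  true  false false true  hu hv (_ , g , _) = ≡.refl , ≡.sym (g ≡.refl)
  ⇒ true  false k     false true  hu hv (g , _) = ≡.refl , ≡.sym (g ≡.refl)
  ⇒ true  true  true  false false hu hv (_ , _ , g) = ≡.refl , g ≡.refl
  ⇒ true  true  false false false hu hv g = ≡.refl , ≡.refl
  ⇒ true  false k     false false hu hv g = ≡.refl , ≡.refl
  ⇒ false false true  true  false hu hv g = ≡.refl , ≡.refl
  ⇒ false false false true  false hu hv (_ , g , _) = ≡.sym (g ≡.refl) , ≡.refl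
  ⇒ false true  k     true  false hu hv (g , _) = ≡.sym (g ≡.refl) , ≡.refl
  ⇒ false false true  false false hu hv (_ , _ , g) = g ≡.refl , ≡.refl
  ⇒ false false false false false hu hv g = ≡.refl , ≡.refl
  ⇒ false true  k     false false hu hv g = ≡.refl , ≡.refl
  ⇐ : ∀ p a k u v → u ≡ not p ∧ (not a ∧ k) × v ≡ p ∧ (a ∧ k) →
    GapAdmissible u v (p ∧ not a) (not p ∧ not (not a)) k
  ⇐ true  true  true  _ _ (≡.refl , ≡.refl) = (λ _ → ≡.refl) , (λ _ → ≡.refl) , (λ _ → ≡.refl)
  ⇐ true  true  false _ _ (≡.refl , ≡.refl) = (λ ()) , (λ ()) , (λ ())
  ⇐ true  false k     _ _ (≡.refl , ≡.refl) = (λ ()) , (λ ()) , (λ _ → ≡.refl)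
  ⇐ false true  k     _ _ (≡.refl , ≡.refl) = (λ ()) , (λ ()) , (λ _ → ≡.refl)
  ⇐ false false true  _ _ (≡.refl , ≡.refl) = (λ _ → ≡.refl) , (λ _ → ≡.refl) , (λ _ → ≡.refl)
  ⇐ false false false _ _ (≡.refl , ≡.refl) = (λ ()) , (λ ()) , (λ ())

lookup-runGaps : ∀ {n} p (X K : Vec Bool n) i →
  lookup (runGaps p X K) i ≡ lookup (shift p X) i ∧ (lookup X i ∧ lookup K i)
lookup-runGaps p X K i = ≡.trans (VP.lookup-zipWith _∧_ i (shift p X) (X ∩ K))
  (≡.cong (lookup (shift p X) i ∧_) (VP.lookup-zipWith _∧_ i X K))

lookup-runEnds : ∀ {n} p (X : Vec Bool n) i →
  lookup (runEnds p X) i ≡ lookup (shift p X) i ∧ not (lookup X i)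
lookup-runEnds p X i = ≡.trans (VP.lookup-zipWith _∧_ i (shift p X) (∁ X))
  (≡.cong (lookup (shift p X) i ∧_) (VP.lookup-map i not X))

shift-∁ : ∀ {n} p (X : Vec Bool n) → shift (not p) (∁ X) ≡ ∁ (shift p X)
shift-∁ p []      = ≡.refl
shift-∁ p (a ∷ X) = ≡.cong (not p ∷_) (shift-∁ a X)

lookup-shift-∁ : ∀ {n} p (X : Vec Bool n) i → lookup (shift (not p) (∁ X)) i ≡ not (lookup (shift p X) i)
lookup-shift-∁ p X i = ≡.trans (≡.cong (λ V → lookup V i) (shift-∁ p X)) (VP.lookup-map i not (shift p X))

lookup-injective : ∀ {n} (U V : Vec Bool n) → (∀ i → lookup U i ≡ lookup V i) → U ≡ V
lookup-injective U V h = ≡.trans (≡.sym (VP.tabulate∘lookup U)) (≡.trans (VP.tabulate-cong h) (VP.tabulate∘lookup V))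

compatible : ∀ {N m n} → List ℕ → Subset N → Subset m → Subset n → Bool
compatible L A I J = admissible (sharp A I J) (cset A) L

-- A gap of A in the run structure is either inside a run of A or of its complement, where K
-- dictates the bit of J or I, or it lies in c(A), where that bit has to vanish.
compatible⇔ : ∀ {l m n} a (X K : Vec Bool l) (I : Subset m) (J : Subset n) →
  m ≡ pred ∣ ∁ (a ∷ X) ∣ → n ≡ pred ∣ a ∷ X ∣ →
  (compatible (elems K) (a ∷ X) I J ≡ true) ⇔
  (toList I ≡ List.drop 1 (joinsFrom (not a) (∁ X) K) × toList J ≡ List.drop 1 (joinsFrom a X K))
compatible⇔ a X K I J em en
  rewrite select-spread 1 (not a) (∁ X) I em | select-spread 1 a X J en | c₁-elems a X | c₁-elems (not a) (∁ X) = mk⇔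
  (λ h → let g = λ i → to (gaps i) (to adm h i) in
     to eqI (lookup-injective U _ (λ i → ≡.trans (proj₁ (g i)) (≡.sym (rI i)))) ,
     to eqJ (lookup-injective V _ (λ i → ≡.trans (proj₂ (g i)) (≡.sym (lookup-runGaps a X K i)))))
  (λ { (hI , hJ) → from adm (λ i → from (gaps i)
     ( ≡.trans (≡.cong (λ W → lookup W i) (from eqI hI)) (rI i)
     , ≡.trans (≡.cong (λ W → lookup W i) (from eqJ hJ)) (lookup-runGaps a X K i))) })
  where
  U = spread (not a) (∁ X) I
  V = spread a X J
  adm = admissible⇔ U V (runEnds a X) (runEnds (not a) (∁ X)) K
  eqI = spread≡runGaps⇔ (not a) (∁ X) K I em
  eqJ = spread≡runGaps⇔ a X K J en
  rI : ∀ i → lookup (runGaps (not a) (∁ X) K) i ≡ not (lookup (shift a X) i) ∧ (not (lookup X i) ∧ lookup K i)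
  rI i = ≡.trans (lookup-runGaps (not a) (∁ X) K i)
    (≡.cong₂ (λ x y → x ∧ (y ∧ lookup K i)) (lookup-shift-∁ a X i) (VP.lookup-map i not X))
  gaps : ∀ i → GapAdmissible (lookup U i) (lookup V i) (lookup (runEnds a X) i) (lookup (runEnds (not a) (∁ X)) i) (lookup K i) ⇔
    (lookup U i ≡ not (lookup (shift a X) i) ∧ (not (lookup X i) ∧ lookup K i) ×
     lookup V i ≡ lookup (shift a X) i ∧ (lookup X i ∧ lookup K i))
  gaps i rewrite lookup-runEnds a X i | lookup-runEnds (not a) (∁ X) i | lookup-shift-∁ a X i | VP.lookup-map i not X =
    gapAdmissible⇔ (lookup (shift a X) i) (lookup X i) (lookup K i) (lookup U i) (lookup V i)
      (λ e → ≡.trans (≡.sym (lookup-shift-∁ a X i)) (spread-⊆-shift (not a) (∁ X) I i e))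
      (spread-⊆-shift a X J i)

-- Counting, and compositions as bit lists

trues : List Bool → ℕ
trues []           = 0
trues (true  ∷ bs) = suc (trues bs)
trues (false ∷ bs) = trues bs

∣∣-toList : ∀ {n} (I : Subset n) → ∣ I ∣ ≡ trues (toList I)
∣∣-toList []          = ≡.refl
∣∣-toList (true  ∷ I) = ≡.cong suc (∣∣-toList I)
∣∣-toList (false ∷ I) = ∣∣-toList I

trues-drop-joins : ∀ {n} (X K : Vec Bool n) → trues (List.drop 1 (joins false X K)) ≡ trues (joins false X K)
trues-drop-joins []          []      = ≡.refl
trues-drop-joins (true  ∷ X) (k ∷ K) = ≡.refl
trues-drop-joins (false ∷ X) (k ∷ K) = trues-drop-joins X K

trues-joinsFrom : ∀ {n} p (X K : Vec Bool n) → trues (List.drop 1 (joinsFrom p X K)) ≡ trues (joins p X K)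
trues-joinsFrom true  X K = ≡.refl
trues-joinsFrom false X K = trues-drop-joins X K

length-filter-elemsFrom : ∀ {n} (p : ℕ → Bool) s (U V : Vec Bool n) → (∀ i → p (s ℕ.+ toℕ i) ≡ lookup V i) →
  length (filterᵇ p (elemsFrom s U)) ≡ ∣ U ∩ V ∣
length-filter-elemsFrom p s []          []      h = ≡.refl
length-filter-elemsFrom p s (false ∷ U) (v ∷ V) h =
  length-filter-elemsFrom p (suc s) U V (λ i → ≡.trans (≡.cong p (≡.sym (NP.+-suc s (toℕ i)))) (h (suc i)))
length-filter-elemsFrom p s (true ∷ U) (v ∷ V) h
  with p s | ≡.subst (λ x → p x ≡ v) (NP.+-identityʳ s) (h zero)
... | true  | ≡.refl = ≡.cong suc (length-filter-elemsFrom p (suc s) U V (λ i →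
   ≡.trans (≡.cong p (≡.sym (NP.+-suc s (toℕ i)))) (h (suc i))))
... | false | ≡.refl = length-filter-elemsFrom p (suc s) U V (λ i → ≡.trans (≡.cong p (≡.sym (NP.+-suc s (toℕ i)))) (h (suc i)))

-- `compGo` on lists, where bit sequences can be joined without transport along sums of lengths.
compL : List Bool → ℕ → List ℕ
compL []           c = c ∷ []
compL (true  ∷ bs) c = c ∷ compL bs 1
compL (false ∷ bs) c = compL bs (suc c)

compGo-toList : ∀ {n} (I : Vec Bool n) c → compGo I c ≡ compL (toList I) c
compGo-toList []          c = ≡.refl
compGo-toList (true  ∷ I) c = ≡.cong (c ∷_) (compGo-toList I 1)
compGo-toList (false ∷ I) c = compGo-toList I (suc c)

compL-∷ : ∀ bs c → ∃₂ λ x xs → compL bs c ≡ x ∷ xs × c ≤ x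
compL-∷ []           c = c , [] , ≡.refl , NP.≤-refl
compL-∷ (true  ∷ bs) c = c , compL bs 1 , ≡.refl , NP.≤-refl
compL-∷ (false ∷ bs) c with compL-∷ bs (suc c)
... | x , xs , e , h = x , xs , e , NP.<⇒≤ h

compL-suc≢ : ∀ bs c {xs} → compL bs (suc c) ≢ c ∷ xs
compL-suc≢ bs c e with compL-∷ bs (suc c)
... | x , xs , e′ , h with ≡.trans (≡.sym e′) e
... | ≡.refl = NP.<-irrefl ≡.refl h

compL-≢[] : ∀ bs c → compL bs c ≢ []
compL-≢[] bs c e with compL-∷ bs c
... | _ , _ , e′ , _ with ≡.trans (≡.sym e′) e
... | ()

-- A cut closes a part of size exactly c, whereas a merge makes that part exceed c.
compL-injective : ∀ as bs c → compL as c ≡ compL bs c → as ≡ bs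
compL-injective []           []           c e = ≡.refl
compL-injective []           (true  ∷ bs) c e = contradiction (≡.sym (LP.∷-injectiveʳ e)) (compL-≢[] bs 1)
compL-injective []           (false ∷ bs) c e = contradiction (≡.sym e) (compL-suc≢ bs c)
compL-injective (true  ∷ as) []           c e = contradiction (LP.∷-injectiveʳ e) (compL-≢[] as 1)
compL-injective (false ∷ as) []           c e = contradiction e (compL-suc≢ as c)
compL-injective (true  ∷ as) (true  ∷ bs) c e = ≡.cong (true ∷_) (compL-injective as bs 1 (LP.∷-injectiveʳ e))
compL-injective (true  ∷ as) (false ∷ bs) c e = contradiction (≡.sym e) (compL-suc≢ bs c)
compL-injective (false ∷ as) (true  ∷ bs) c e = contradiction e (compL-suc≢ as c)
compL-injective (false ∷ as) (false ∷ bs) c e = ≡.cong (false ∷_) (compL-injective as bs (suc c) e)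

sum-compL : ∀ bs c → sum (compL bs c) ≡ length bs ℕ.+ c
sum-compL []           c = NP.+-identityʳ c
sum-compL (true  ∷ bs) c = ≡.trans (≡.cong (c ℕ.+_) (sum-compL bs 1))
  (≡.trans (NP.+-comm c _) (≡.cong (ℕ._+ c) (NP.+-comm (length bs) 1)))
sum-compL (false ∷ bs) c = ≡.trans (sum-compL bs (suc c)) (NP.+-suc (length bs) c)

compL-falses : ∀ d bs c → compL (List.replicate d false ++ bs) c ≡ compL bs (d ℕ.+ c)
compL-falses zero    bs c = ≡.refl
compL-falses (suc d) bs c = ≡.trans (compL-falses d bs (suc c)) (≡.cong (compL bs) (NP.+-suc d c))

compL-surjective : ∀ a α → IsComposition (a ∷ α) → ∃ λ bs → compL bs 1 ≡ a ∷ α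
compL-surjective zero    _       (() ∷ _)
-- A part of size `suc a` has `a` inner gaps, all merged.
compL-surjective (suc a) []      _ = List.replicate a false ++ [] ,
  ≡.trans (compL-falses a [] 1) (≡.cong (_∷ []) (NP.+-comm a 1))
compL-surjective (suc a) (b ∷ β) (_ ∷ pos) with compL-surjective b β pos
... | bs , e = List.replicate a false ++ true ∷ bs ,
  ≡.trans (compL-falses a (true ∷ bs) 1) (≡.cong₂ _∷_ (NP.+-comm a 1) e)

compL-+ : ∀ bs c d → compL bs (c ℕ.+ d) ≡ (c ∷ []) ⊙ compL bs d
compL-+ []           c d = ≡.refl
compL-+ (true  ∷ bs) c d = ≡.refl
compL-+ (false ∷ bs) c d = ≡.trans (≡.cong (compL bs) (≡.sym (NP.+-suc c d))) (compL-+ bs c (suc d))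

-- Near-concatenation merges across the boundary, so the gap between the two bit lists is no partial
-- sum: its bit is `false`.
compL-⊙ : ∀ as bs c → compL (as ++ false ∷ bs) c ≡ compL as c ⊙ compL bs 1
compL-⊙ []           bs c = ≡.trans (≡.cong (compL bs) (NP.+-comm 1 c)) (compL-+ bs c 1)
compL-⊙ (false ∷ as) bs c = compL-⊙ as bs (suc c)
compL-⊙ (true  ∷ as) bs c with compL as 1 | compL-≢[] as 1 | compL-⊙ as bs 1
... | []    | ne | _ = contradiction ≡.refl ne
... | x ∷ α | _  | e = ≡.cong (c ∷_) e

⊙-identityʳ : ∀ α → α ⊙ [] ≡ α
⊙-identityʳ []            = ≡.refl
⊙-identityʳ (a ∷ [])      = ≡.refl
⊙-identityʳ (a ∷ a′ ∷ α) = ≡.cong (a ∷_) (⊙-identityʳ (a′ ∷ α))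

fromList′ : ∀ l {n} → length l ≡ n → ∃ λ (I : Vec Bool n) → toList I ≡ l
fromList′ l ≡.refl = Vec.fromList l , VP.toList∘fromList l

toList-injective : ∀ {n} (I J : Vec Bool n) → toList I ≡ toList J → I ≡ J
toList-injective I J e = ≡.trans (≡.sym (VP.cast-is-id ≡.refl I)) (VP.toList-injective ≡.refl I J e)

-- Finite sums and linear functionals on formal sums

module Eval {c ℓ : Level} (R : CommutativeRing c ℓ) where
  open CommutativeRing R
  open NSym R
  open import Algebra.Solver.Ring.NaturalCoefficients.Default commutativeSemiring using (solve; _:=_; _:+_; _:*_)

  private variable
    a b : Level
    X Y : Set a

  ∑ : List X → (X → Carrier) → Carrier
  ∑ []       f = 0#
  ∑ (x ∷ xs) f = f x + ∑ xs f

  ∑-cong : ∀ (xs : List X) {f g : X → Carrier} → (∀ x → f x ≈ g x) → ∑ xs f ≈ ∑ xs g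
  ∑-cong []       h = refl
  ∑-cong (x ∷ xs) h = +-cong (h x) (∑-cong xs h)

  ∑-++ : ∀ (xs ys : List X) f → ∑ (xs ++ ys) f ≈ ∑ xs f + ∑ ys f
  ∑-++ []       ys f = sym (+-identityˡ _)
  ∑-++ (x ∷ xs) ys f = trans (+-congˡ (∑-++ xs ys f)) (sym (+-assoc _ _ _))

  ∑-map : ∀ (g : X → Y) xs f → ∑ (List.map g xs) f ≈ ∑ xs (f ∘ g)
  ∑-map g []       f = refl
  ∑-map g (x ∷ xs) f = +-congˡ (∑-map g xs f)

  ∑-concatMap : ∀ (g : X → List Y) xs f → ∑ (concatMap g xs) f ≈ ∑ xs (λ x → ∑ (g x) f)
  ∑-concatMap g []       f = refl
  ∑-concatMap g (x ∷ xs) f = trans (∑-++ (g x) _ f) (+-congˡ (∑-concatMap g xs f))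

  ∑-filterᵇ : ∀ (p : X → Bool) xs f → ∑ (filterᵇ p xs) f ≈ ∑ xs (λ x → if p x then f x else 0#)
  ∑-filterᵇ p []       f = refl
  ∑-filterᵇ p (x ∷ xs) f with p x
  ... | true  = +-congˡ (∑-filterᵇ p xs f)
  ... | false = trans (∑-filterᵇ p xs f) (sym (+-identityˡ _))

  ∑-zero : ∀ (xs : List X) {f} → (∀ x → f x ≈ 0#) → ∑ xs f ≈ 0#
  ∑-zero []       h = refl
  ∑-zero (x ∷ xs) h = trans (+-cong (h x) (∑-zero xs h)) (+-identityˡ 0#)

  ∑-+ : ∀ (xs : List X) f g → ∑ xs (λ x → f x + g x) ≈ ∑ xs f + ∑ xs g
  ∑-+ []       f g = sym (+-identityˡ 0#)
  ∑-+ (x ∷ xs) f g = trans (+-congˡ (∑-+ xs f g))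
    (solve 4 (λ a b c d → (a :+ b) :+ (c :+ d) := (a :+ c) :+ (b :+ d)) refl _ _ _ _)

  ∑-*ˡ : ∀ (xs : List X) r f → ∑ xs (λ x → r * f x) ≈ r * ∑ xs f
  ∑-*ˡ []       r f = sym (zeroʳ r)
  ∑-*ˡ (x ∷ xs) r f = trans (+-congˡ (∑-*ˡ xs r f)) (sym (distribˡ r _ _))

  ∑-*ʳ : ∀ (xs : List X) r f → ∑ xs (λ x → f x * r) ≈ ∑ xs f * r
  ∑-*ʳ xs r f = trans (∑-cong xs (λ x → *-comm (f x) r)) (trans (∑-*ˡ xs r f) (*-comm r _))

  ∑-swap : ∀ (xs : List X) (ys : List Y) (f : X → Y → Carrier) → ∑ xs (λ x → ∑ ys (f x)) ≈ ∑ ys (λ y → ∑ xs (λ x → f x y))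
  ∑-swap []       ys f = sym (∑-zero ys (λ _ → refl))
  ∑-swap (x ∷ xs) ys f = trans (+-congˡ (∑-swap xs ys f)) (sym (∑-+ ys (f x) _))

  ∑-∷ʳ : ∀ (xs : List X) x f → ∑ (xs List.∷ʳ x) f ≈ ∑ xs f + f x
  ∑-∷ʳ xs x f = trans (∑-++ xs (x ∷ []) f) (+-congˡ (+-identityʳ (f x)))

  ∑-upTo : ∀ n f → ∑ (upTo (suc n)) f ≈ ∑ (upTo n) f + f n
  ∑-upTo n f = trans (reflexive (≡.cong (λ xs → ∑ xs f) (≡.sym (LP.upTo-∷ʳ n)))) (∑-∷ʳ (upTo n) n f)

  ∑-upTo-cong : ∀ n {f g : ℕ → Carrier} → (∀ i → i < n → f i ≈ g i) → ∑ (upTo n) f ≈ ∑ (upTo n) g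
  ∑-upTo-cong zero    h = refl
  ∑-upTo-cong (suc n) h = trans (∑-upTo n _) (trans
    (+-cong (∑-upTo-cong n (λ i i<n → h i (NP.m<n⇒m<1+n i<n))) (h n NP.≤-refl)) (sym (∑-upTo n _)))

  ∑-upTo-single : ∀ n j → j < n → (f : ℕ → Carrier) → (∀ i → i < n → i ≢ j → f i ≈ 0#) → ∑ (upTo n) f ≈ f j
  ∑-upTo-single (suc n) j j<n f h with j NP.≟ n
  ... | yes ≡.refl = trans (∑-upTo n f) (trans (+-congʳ (trans
          (∑-upTo-cong n (λ i i<n → h i (NP.m<n⇒m<1+n i<n) (NP.<⇒≢ i<n))) (∑-zero (upTo n) (λ _ → refl))))
          (+-identityˡ (f j)))
  ... | no j≢n = trans (∑-upTo n f) (trans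
          (+-cong (∑-upTo-single n j (NP.≤∧≢⇒< (NP.≤-pred j<n) j≢n) f (λ i i<n → h i (NP.m<n⇒m<1+n i<n)))
                  (h n NP.≤-refl (j≢n ∘ ≡.sym)))
          (+-identityʳ (f j)))

  ∑-allSubsets : ∀ n (f : Subset (suc n) → Carrier) →
    ∑ (allSubsets (suc n)) f ≈ ∑ (allSubsets n) (f ∘ (false ∷_)) + ∑ (allSubsets n) (f ∘ (true ∷_))
  ∑-allSubsets n f = trans (∑-++ (List.map (false ∷_) (allSubsets n)) _ f)
    (+-cong (∑-map (false ∷_) (allSubsets n) f) (∑-map (true ∷_) (allSubsets n) f))

  ∑-allSubsets-single : ∀ {n} (I : Subset n) f → (∀ J → J ≢ I → f J ≈ 0#) → ∑ (allSubsets n) f ≈ f I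
  ∑-allSubsets-single []          f h = +-identityʳ _
  ∑-allSubsets-single {suc n} (false ∷ I) f h = trans (∑-allSubsets n f) (trans
    (+-cong (∑-allSubsets-single I _ (λ J ne → h _ (ne ∘ VP.∷-injectiveʳ)))
            (∑-zero (allSubsets n) (λ J → h _ λ ()))) (+-identityʳ _))
  ∑-allSubsets-single {suc n} (true ∷ I) f h = trans (∑-allSubsets n f) (trans
    (+-cong (∑-zero (allSubsets n) (λ J → h _ λ ()))
            (∑-allSubsets-single I _ (λ J ne → h _ (ne ∘ VP.∷-injectiveʳ)))) (+-identityˡ _))

  -- The linear functional with values φ on the basis. Testing equality against all of them turns
  -- products and coproducts into iterated sums.
  ⟦_⟧ : List (Carrier × X) → (X → Carrier) → Carrier
  ⟦ x ⟧ φ = ∑ x (λ (r , α) → r * φ α)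

  ⟦⟧-cong : ∀ (x : List (Carrier × X)) {φ ψ} → (∀ α → φ α ≈ ψ α) → ⟦ x ⟧ φ ≈ ⟦ x ⟧ ψ
  ⟦⟧-cong x h = ∑-cong x (λ (r , α) → *-congˡ (h α))

  coeff-⟦⟧ : ∀ x α → coeff x α ≈ ⟦ x ⟧ (λ β → if ⌊ β ≟C α ⌋ then 1# else 0#)
  coeff-⟦⟧ []            α = refl
  coeff-⟦⟧ ((r , β) ∷ x) α with ⌊ β ≟C α ⌋
  ... | true  = +-cong (sym (*-identityʳ r)) (coeff-⟦⟧ x α)
  ... | false = trans (coeff-⟦⟧ x α) (sym (trans (+-congʳ (zeroʳ r)) (+-identityˡ _)))

  coeff²-⟦⟧ : ∀ x α β → coeff² x α β ≈ ⟦ x ⟧ (λ (α′ , β′) → if ⌊ α′ ≟C α ⌋ ∧ ⌊ β′ ≟C β ⌋ then 1# else 0#)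
  coeff²-⟦⟧ []            α β = refl
  coeff²-⟦⟧ ((r , (α′ , β′)) ∷ x) α β with ⌊ α′ ≟C α ⌋ ∧ ⌊ β′ ≟C β ⌋
  ... | true  = +-cong (sym (*-identityʳ r)) (coeff²-⟦⟧ x α β)
  ... | false = trans (coeff²-⟦⟧ x α β) (sym (trans (+-congʳ (zeroʳ r)) (+-identityˡ _)))

  ≋-from-⟦⟧ : ∀ x y → (∀ φ → ⟦ x ⟧ φ ≈ ⟦ y ⟧ φ) → x ≋ y
  ≋-from-⟦⟧ x y h α = trans (coeff-⟦⟧ x α) (trans (h _) (sym (coeff-⟦⟧ y α)))

  ≋²-from-⟦⟧ : ∀ x y → (∀ φ → ⟦ x ⟧ φ ≈ ⟦ y ⟧ φ) → x ≋² y
  ≋²-from-⟦⟧ x y h α β = trans (coeff²-⟦⟧ x α β) (trans (h _) (sym (coeff²-⟦⟧ y α β)))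

  ⟦scale²⟧ : ∀ r x φ → ⟦ scale² r x ⟧ φ ≈ r * ⟦ x ⟧ φ
  ⟦scale²⟧ r x φ = trans (∑-map _ x _) (trans (∑-cong x (λ _ → *-assoc _ _ _)) (∑-*ˡ x r _))

  ⟦product⟧ : ∀ {A B C : Set} (op : A → B → C) (x : List (Carrier × A)) (y : List (Carrier × B)) (φ : C → Carrier) →
    ∑ x (λ (r , α) → ∑ y (λ (s , β) → (r * s) * φ (op α β))) ≈ ⟦ x ⟧ (λ α → ⟦ y ⟧ (λ β → φ (op α β)))
  ⟦product⟧ op x y φ = ∑-cong x (λ (r , α) → trans (∑-cong y (λ _ → *-assoc _ _ _)) (∑-*ˡ y r _))

  ⟦·⟧ : ∀ x y φ → ⟦ x · y ⟧ φ ≈ ⟦ x ⟧ (λ α → ⟦ y ⟧ (λ β → φ (α ++ β)))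
  ⟦·⟧ x y φ = trans (∑-concatMap _ x _) (trans (∑-cong x (λ _ → ∑-map _ y _)) (⟦product⟧ _++_ x y φ))

  ⟦⊗⟧ : ∀ x y φ → ⟦ x ⊗ y ⟧ φ ≈ ⟦ x ⟧ (λ α → ⟦ y ⟧ (λ β → φ (α , β)))
  ⟦⊗⟧ x y φ = trans (∑-concatMap _ x _) (trans (∑-cong x (λ _ → ∑-map _ y _)) (⟦product⟧ _,_ x y φ))

  ⟦·²⟧ : ∀ x y φ → ⟦ x ·² y ⟧ φ ≈ ⟦ x ⟧ (λ (α , β) → ⟦ y ⟧ (λ (α′ , β′) → φ (α ++ α′ , β ++ β′)))
  ⟦·²⟧ x y φ = trans (∑-concatMap _ x _) (trans (∑-cong x (λ _ → ∑-map _ y _))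
    (⟦product⟧ (λ (α , β) (α′ , β′) → (α ++ α′ , β ++ β′)) x y φ))

  -- An empty block contributes no part, as H_0 = 1.
  block : ℕ → List ℕ
  block zero    = []
  block (suc c) = suc c ∷ []

  ⟦H-block⟧ : ∀ i φ → ⟦ H (i ∷ []) ⟧ φ ≈ φ (block i)
  ⟦H-block⟧ zero    φ = trans (+-identityʳ _) (*-identityˡ _)
  ⟦H-block⟧ (suc i) φ = trans (+-identityʳ _) (*-identityˡ _)

  filter-compGo : ∀ {n} (J : Vec Bool n) c → filterᵇ (λ a → not (a ≡ᵇ 0)) (compGo J (suc c)) ≡ compGo J (suc c)
  filter-compGo []          c = ≡.refl
  filter-compGo (true  ∷ J) c = ≡.cong (suc c ∷_) (filter-compGo J 0)
  filter-compGo (false ∷ J) c = filter-compGo J (suc c)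

  ⟦△gen⟧ : ∀ a φ → ⟦ △gen a ⟧ φ ≈ ∑ (upTo (suc a)) (λ i → φ (block i , block (a ∸ i)))
  ⟦△gen⟧ a φ = trans (∑-concatMap (λ i → H (i ∷ []) ⊗ H ((a ∸ i) ∷ [])) (upTo (suc a)) _)
    (∑-cong (upTo (suc a)) (λ i → trans (⟦⊗⟧ (H (i ∷ [])) (H ((a ∸ i) ∷ [])) φ) (trans
      (⟦H-block⟧ i (λ α → ⟦ H ((a ∸ i) ∷ []) ⟧ (λ β → φ (α , β)))) (⟦H-block⟧ (a ∸ i) (λ β → φ (block i , β))))))

  ⟦△⟧ : ∀ x φ → ⟦ △ x ⟧ φ ≈ ⟦ x ⟧ (λ α → ⟦ △H α ⟧ φ)
  ⟦△⟧ x φ = trans (∑-concatMap _ x _) (∑-cong x (λ (r , α) → ⟦scale²⟧ r (△H α) φ))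

-- B(q,t)_I evaluated by reading the gaps from left to right

module Ribbon {c ℓ : Level} (R : CommutativeRing c ℓ) (q t : CommutativeRing.Carrier R) where
  open CommutativeRing R
  open NSym R
  open Eval R
  open import Algebra.Solver.Ring.NaturalCoefficients.Default commutativeSemiring using (solve; _:=_; _:+_; _:*_)

  -- A false bit is a gap that is always cut, a true bit one that is merged or cut; c is the size of the
  -- block read so far.
  ribbon : List Bool → ℕ → (Comp → Carrier) → Carrier
  ribbon []           c ψ = ψ (block c ++ [])
  ribbon (false ∷ bs) c ψ = ribbon bs 1 (λ α → ψ (block c ++ α))
  ribbon (true  ∷ bs) c ψ = q * ribbon bs (suc c) ψ + t * ribbon bs 1 (λ α → ψ (block c ++ α))

  ribbon-cong : ∀ bs c {φ ψ} → (∀ α → φ α ≈ ψ α) → ribbon bs c φ ≈ ribbon bs c ψ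
  ribbon-cong []           c h = h _
  ribbon-cong (false ∷ bs) c h = ribbon-cong bs 1 (λ α → h _)
  ribbon-cong (true  ∷ bs) c h = +-cong (*-congˡ (ribbon-cong bs (suc c) h)) (*-congˡ (ribbon-cong bs 1 (λ α → h _)))

  ribbon-+ : ∀ bs c φ ψ → ribbon bs c (λ α → φ α + ψ α) ≈ ribbon bs c φ + ribbon bs c ψ
  ribbon-+ []           c φ ψ = refl
  ribbon-+ (false ∷ bs) c φ ψ = ribbon-+ bs 1 _ _
  ribbon-+ (true  ∷ bs) c φ ψ = trans
    (+-cong (*-congˡ (ribbon-+ bs (suc c) φ ψ)) (*-congˡ (ribbon-+ bs 1 _ _)))
    (solve 6 (λ q t w x y z → q :* (w :+ x) :+ t :* (y :+ z) := (q :* w :+ t :* y) :+ (q :* x :+ t :* z)) refl q t _ _ _ _)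

  ribbon-* : ∀ bs c r φ → ribbon bs c (λ α → r * φ α) ≈ r * ribbon bs c φ
  ribbon-* []           c r φ = refl
  ribbon-* (false ∷ bs) c r φ = ribbon-* bs 1 r _
  ribbon-* (true  ∷ bs) c r φ = trans (+-cong (*-congˡ (ribbon-* bs (suc c) r φ)) (*-congˡ (ribbon-* bs 1 r _)))
    (solve 5 (λ q t r x y → q :* (r :* x) :+ t :* (r :* y) := r :* (q :* x :+ t :* y)) refl q t r _ _)

  ribbon-0 : ∀ bs c → ribbon bs c (λ _ → 0#) ≈ 0#
  ribbon-0 bs c = trans (ribbon-cong bs c (λ _ → sym (zeroˡ 0#))) (trans (ribbon-* bs c 0# (λ _ → 0#)) (zeroˡ _))

  ribbon-∑ : ∀ {a} {X : Set a} bs c (xs : List X) (f : X → Comp → Carrier) →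
    ribbon bs c (λ α → ∑ xs (λ x → f x α)) ≈ ∑ xs (λ x → ribbon bs c (f x))
  ribbon-∑ bs c []       f = ribbon-0 bs c
  ribbon-∑ bs c (x ∷ xs) f = trans (ribbon-+ bs c (f x) _) (+-congˡ (ribbon-∑ bs c xs f))

  -- A `false` gap separates blocks in every term, so the evaluation splits there. Starting from
  -- `suc c` makes each block a literal singleton, and reassociation is definitional.
  ribbon-++ : ∀ as bs c ψ → ribbon (as ++ false ∷ bs) (suc c) ψ ≈ ribbon as (suc c) (λ α → ribbon bs 1 (λ β → ψ (α ++ β)))
  ribbon-++ []           bs c ψ = refl
  ribbon-++ (false ∷ as) bs c ψ = ribbon-++ as bs 0 _
  ribbon-++ (true  ∷ as) bs c ψ = +-cong (*-congˡ (ribbon-++ as bs (suc c) ψ)) (*-congˡ (ribbon-++ as bs 0 _))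

  -- Replaces the decision whether I ∪ J is everything by a test that reduces on the first bit, so
  -- that the sum over J can recurse.
  isFull : ∀ {n} → Subset n → Bool
  isFull []      = true
  isFull (b ∷ U) = b ∧ isFull U

  ≟⊤-isFull : ∀ {n} (U : Subset n) → ⌊ VP.≡-dec BP._≟_ U ⊤ ⌋ ≡ isFull U
  ≟⊤-isFull U = ≡.trans (isYes≗does (VP.≡-dec BP._≟_ U ⊤)) (go U)
    where
    go : ∀ {n} (U : Subset n) → does (VP.≡-dec BP._≟_ U ⊤) ≡ isFull U
    go []          = ≡.refl
    go (true  ∷ U) = go U
    go (false ∷ U) = ≡.refl

  cut : ∀ {n} → Subset n → Subset n → (Comp → Carrier) → ℕ → Carrier
  cut I J ψ c = if isFull (I ∪ J) then (pow q ∣ I ∩ ∁ J ∣ * pow t ∣ I ∩ J ∣) * ψ (compGo J (suc c)) else 0#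

  if-cong : ∀ b {x y : Carrier} → x ≈ y → (if b then x else 0#) ≈ (if b then y else 0#)
  if-cong true  e = e
  if-cong false e = refl

  if-≡ : ∀ {b c} {x : Carrier} → b ≡ c → (if b then x else 0#) ≈ (if c then x else 0#)
  if-≡ ≡.refl = refl

  if-* : ∀ b r x → (if b then r * x else 0#) ≈ r * (if b then x else 0#)
  if-* true  r x = refl
  if-* false r x = sym (zeroʳ r)

  -- A gap outside I must lie in J and cuts. A gap of I is either left out of J, with weight q, and
  -- the block grows, or put into J, with weight t, and a new block begins.
  ∑-cut : ∀ {n} (I : Subset n) c ψ → ∑ (allSubsets n) (λ J → cut I J ψ c) ≈ ribbon (toList I) (suc c) ψ
  ∑-cut []          c ψ = trans (+-identityʳ _) (trans (*-congʳ (*-identityˡ 1#)) (*-identityˡ _))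
  ∑-cut {suc n} (false ∷ I) c ψ = trans (∑-allSubsets n (λ J → cut (false ∷ I) J ψ c)) (trans
    (+-cong (∑-zero (allSubsets n) (λ _ → refl)) (∑-cut I 0 (λ α → ψ (suc c ∷ α)))) (+-identityˡ _))
  ∑-cut {suc n} (true ∷ I) c ψ = trans (∑-allSubsets n (λ J → cut (true ∷ I) J ψ c)) (+-cong
    (trans (∑-cong (allSubsets n) (λ J → trans (if-cong (isFull (I ∪ J))
              (trans (*-congʳ (*-assoc _ _ _)) (*-assoc _ _ _))) (if-* (isFull (I ∪ J)) q _)))
      (trans (∑-*ˡ (allSubsets n) q _) (*-congˡ (∑-cut I (suc c) ψ))))
    (trans (∑-cong (allSubsets n) (λ J → trans (if-cong (isFull (I ∪ J))
              (solve 4 (λ x t y z → (x :* (t :* y)) :* z := t :* ((x :* y) :* z)) refl _ t _ _)) (if-* (isFull (I ∪ J)) t _)))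
      (trans (∑-*ˡ (allSubsets n) t _) (*-congˡ (∑-cut I 0 (λ α → ψ (suc c ∷ α)))))))

  ⟦Bset⟧ : ∀ n (I : Subset n) ψ → ⟦ Bset q t (suc n) I ⟧ ψ ≈ ribbon (toList I) 1 ψ
  ⟦Bset⟧ n I ψ = trans (∑-concatMap _ (filterᵇ _ (allSubsets n)) _)
    (trans (∑-filterᵇ _ (allSubsets n) _)
    (trans (∑-cong (allSubsets n) (λ J → trans (if-≡ (≟⊤-isFull (I ∪ J))) (if-cong (isFull (I ∪ J)) (trans (+-identityʳ _)
       (*-cong (*-identityʳ _) (reflexive (≡.cong ψ (filter-compGo J 0))))))))
    (∑-cut I 0 ψ)))

  ⟦Bset0⟧ : ∀ ψ → ⟦ Bset q t 0 [] ⟧ ψ ≈ ψ []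
  ⟦Bset0⟧ ψ = trans (+-identityʳ _) (trans (*-congʳ (trans (*-identityʳ _) (*-identityˡ 1#))) (*-identityˡ _))

-- Products: part (b)

module Words {c ℓ : Level} (R : CommutativeRing c ℓ) (q t : CommutativeRing.Carrier R) where
  open CommutativeRing R
  open NSym R
  open Eval R
  open Ribbon R q t
  open import Algebra.Solver.Ring.NaturalCoefficients.Default commutativeSemiring using (solve; _:=_; _:+_; _:*_; con)

  -- `B` with the size as a separate argument, since `sum (compL bs 1)` equals `suc (length bs)`
  -- only propositionally.
  ∑B : ℕ → Comp → NS
  ∑B n α = concatMap (Bset q t n) (filterᵇ (λ I → ⌊ comp n I ≟C α ⌋) (allSubsets (pred n)))

  isYes-true : ∀ α β → α ≡ β → ⌊ α ≟C β ⌋ ≡ true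
  isYes-true α β e = ≡.trans (isYes≗does (α ≟C β)) (dec-true (α ≟C β) e)

  isYes-false : ∀ α β → α ≢ β → ⌊ α ≟C β ⌋ ≡ false
  isYes-false α β e = ≡.trans (isYes≗does (α ≟C β)) (dec-false (α ≟C β) e)

  if-true : ∀ {b} {x : Carrier} → b ≡ true → (if b then x else 0#) ≈ x
  if-true ≡.refl = refl

  if-false : ∀ {b} {x : Carrier} → b ≡ false → (if b then x else 0#) ≈ 0#
  if-false ≡.refl = refl

  -- By `compL-injective` the filter keeps a single subset, the one listed by `bs`.
  ⟦∑B⟧ : ∀ n bs → length bs ≡ n → ∀ ψ → ⟦ ∑B (suc n) (compL bs 1) ⟧ ψ ≈ ribbon bs 1 ψ
  ⟦∑B⟧ n bs e ψ = trans (∑-concatMap (Bset q t (suc n)) (filterᵇ sel (allSubsets n)) _)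
    (trans (∑-filterᵇ sel (allSubsets n) (λ J → ⟦ Bset q t (suc n) J ⟧ ψ))
    (trans (∑-allSubsets-single I _ (λ J J≢I → if-false (isYes-false _ _ (λ h → J≢I
              (toList-injective J I (≡.trans (compL-injective _ _ 1 (≡.trans (≡.sym (compGo-toList J 1)) h)) (≡.sym eI)))))))
    (trans (if-true (isYes-true _ _ (≡.trans (compGo-toList I 1) (≡.cong (λ l → compL l 1) eI))))
    (trans (⟦Bset⟧ n I ψ) (reflexive (≡.cong (λ l → ribbon l 1 ψ) eI))))))
    where
    sel : Subset n → Bool
    sel I = ⌊ comp (suc n) I ≟C compL bs 1 ⌋
    I = proj₁ (fromList′ bs e)
    eI = proj₂ (fromList′ bs e)

  ⟦B⟧ : ∀ bs {α} → compL bs 1 ≡ α → ∀ ψ → ⟦ B q t α ⟧ ψ ≈ ribbon bs 1 ψ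
  ⟦B⟧ bs ≡.refl ψ rewrite ≡.trans (sum-compL bs 1) (NP.+-comm (length bs) 1) = ⟦∑B⟧ (length bs) bs ≡.refl ψ

  ⟦B[]⟧ : ∀ ψ → ⟦ B q t [] ⟧ ψ ≈ ψ []
  ⟦B[]⟧ = ⟦Bset0⟧

  ⟦B·B⟧ : ∀ α β → IsComposition α → IsComposition β → ∀ φ → ⟦ B q t α · B q t β ⟧ φ ≈ ⟦ B q t (α ⊙ β) ⟧ φ
  ⟦B·B⟧ [] β _ _ φ = trans (⟦·⟧ (B q t []) (B q t β) φ) (⟦B[]⟧ (λ α → ⟦ B q t β ⟧ (λ γ → φ (α ++ γ))))
  ⟦B·B⟧ α@(_ ∷ _) [] _ _ φ = trans (⟦·⟧ (B q t α) (B q t []) φ) (trans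
    (⟦⟧-cong (B q t α) (λ γ → trans (⟦B[]⟧ (λ β → φ (γ ++ β))) (reflexive (≡.cong φ (LP.++-identityʳ γ)))))
    (reflexive (≡.cong (λ γ → ⟦ B q t γ ⟧ φ) (≡.sym (⊙-identityʳ α)))))
  ⟦B·B⟧ (a ∷ α) (b ∷ β) pa pb φ = join (compL-surjective a α pa) (compL-surjective b β pb)
    where
    join : ∀ {α β} → (∃ λ as → compL as 1 ≡ α) → (∃ λ bs → compL bs 1 ≡ β) → ⟦ B q t α · B q t β ⟧ φ ≈ ⟦ B q t (α ⊙ β) ⟧ φ
    join (as , ≡.refl) (bs , ≡.refl) = trans (⟦·⟧ (B q t (compL as 1)) (B q t (compL bs 1)) φ)
      (trans (⟦B⟧ as ≡.refl (λ γ → ⟦ B q t (compL bs 1) ⟧ (λ δ → φ (γ ++ δ))))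
      (trans (ribbon-cong as 1 (λ γ → ⟦B⟧ bs ≡.refl (λ δ → φ (γ ++ δ))))
      (trans (sym (ribbon-++ as bs 0 φ)) (sym (⟦B⟧ (as ++ false ∷ bs) (compL-⊙ as bs 1) φ)))))

  -- The coproduct as a recursion over words

  Fun² : Set c
  Fun² = Comp → Comp → Carrier

  -- Left multiplication by a finished block, as the functional sees it: cells outside A go to the
  -- first tensor factor, cells of A to the second.
  put : Bool → ℕ → Fun² → Fun²
  put false c φ α β = φ (block c ++ α) β
  put true  c φ α β = φ α (block c ++ β)

  letterWeight : Bool → Bool → Carrier
  letterWeight false true = q + t
  letterWeight _     _    = t

  -- Sum over all continuations of a word A (a bit per cell, telling whether the cell belongs to A)
  -- whose last run has the letter a and has accumulated an unfinished block of size c.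
  words : Bool → ℕ → List Bool → Fun² → Carrier
  words a c []           φ = put a c φ [] []
  words a c (false ∷ bs) φ = words false 1 bs (put a c φ) + words true 1 bs (put a c φ)
  words a c (true  ∷ bs) φ = q * words a (suc c) bs φ +
    (letterWeight a false * words false 1 bs (put a c φ) + letterWeight a true * words true 1 bs (put a c φ))

  start : List Bool → Fun² → Carrier
  start bs φ = words false 1 bs φ + words true 1 bs φ

  ⟦△H⟧ : Comp → Fun² → Carrier
  ⟦△H⟧ α φ = ⟦ △H α ⟧ (λ (β , γ) → φ β γ)

  ⟦△H⟧-∷ : ∀ a α φ → ⟦△H⟧ (a ∷ α) φ ≈ ∑ (upTo (suc a)) (λ i → ⟦△H⟧ α (put false i (put true (a ∸ i) φ)))
  ⟦△H⟧-∷ a α φ = trans (⟦·²⟧ (△gen a) (△H α) _) (⟦△gen⟧ a _)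

  -- The pending block has c + 1 cells and ends inside A; i counts its leading cells outside A. The
  -- remaining value i = c + 1, a block wholly outside A, is the term `words false (suc c)` beside
  -- it.
  ascents : ℕ → List Bool → Fun² → Carrier
  ascents c bs φ = ∑ (upTo (suc c)) (λ i → words true (suc c ∸ i) bs (put false i φ))

  -- A block of H_{c+1} contributes i cells outside A followed by c+1-i cells inside A.
  mutual
    ribbon-△H : ∀ bs c φ → ribbon bs (suc c) (λ α → ⟦△H⟧ α φ) ≈ words false (suc c) bs φ + ascents c bs φ
    ribbon-△H [] c φ = trans (⟦△H⟧-∷ (suc c) [] φ) (trans (∑-upTo (suc c) _) (trans (+-comm _ _) (+-cong
      (trans (+-identityʳ _) (trans (*-identityˡ _) (reflexive (≡.cong (λ j → φ (suc c ∷ []) (block j ++ [])) (NP.n∸n≡0 c)))))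
      (∑-cong (upTo (suc c)) (λ i → trans (+-identityʳ _) (*-identityˡ _))))))
    ribbon-△H (false ∷ bs) c φ = trans (ribbon-△H-cut bs c φ) (+-comm _ _)
    ribbon-△H (true ∷ bs) c φ = trans
      (+-cong (*-congˡ (trans (ribbon-△H bs (suc c) φ) (+-congˡ (trans (∑-upTo (suc c) _) (+-cong
                (∑-upTo-cong (suc c) (λ i i≤c →
                  reflexive (≡.cong (λ j → words true j bs (put false i φ)) (NP.+-∸-assoc 1 (NP.<⇒≤ i≤c)))))
                (reflexive (≡.cong (λ j → words true j bs (put false (suc c) φ)) (NP.m+n∸n≡m 1 (suc c)))))))))
              (*-congˡ (ribbon-△H-cut bs c φ)))
      -- The term `b` occurs twice: the next cell is the first one inside A, once merged into a
      -- block lying outside A so far, once cut from it. This is the origin of q + t.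
      (trans (solve 7 (λ q t a x b y u → q :* (a :+ (x :+ b)) :+ t :* (y :+ (u :+ b)) :=
                (q :* a :+ (t :* u :+ (q :+ t) :* b)) :+ (q :* x :+ t :* y)) refl q t _ _ _ _ _)
      (+-congˡ (sym (trans (∑-+ (upTo (suc c)) _ _) (+-cong (∑-*ˡ (upTo (suc c)) q _)
         (trans (∑-cong (upTo (suc c)) (λ i → sym (distribˡ t _ _))) (∑-*ˡ (upTo (suc c)) t _)))))))

    -- The block is complete, so the coproduct of its H applies and the next cell starts afresh with
    -- either letter. The split i = c + 1 stays apart as the only one with no cell inside A.
    ribbon-△H-cut : ∀ bs c φ → ribbon bs 1 (λ α → ⟦△H⟧ (suc c ∷ α) φ) ≈
      ∑ (upTo (suc c)) (λ i → start bs (put false i (put true (suc c ∸ i) φ))) + start bs (put false (suc c) φ)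
    ribbon-△H-cut bs c φ = trans (ribbon-cong bs 1 (λ α → ⟦△H⟧-∷ (suc c) α φ))
      (trans (ribbon-∑ bs 1 (upTo (suc (suc c))) (λ i α → ⟦△H⟧ α (put false i (put true (suc c ∸ i) φ))))
      (trans (∑-cong (upTo (suc (suc c))) (λ i → trans (ribbon-△H bs 0 _) (+-congˡ (+-identityʳ _))))
      (trans (∑-upTo (suc c) (λ i → start bs (put false i (put true (suc c ∸ i) φ))))
        (+-congˡ (reflexive (≡.cong (λ j → start bs (put false (suc c) (put true j φ))) (NP.n∸n≡0 c)))))))

  -- The same recursion as a sum over the words A

  -- A gap of K between equal letters has weight 1 here, because the ribbon of I or J supplies its q
  -- or t.
  gapWeight : Bool → Bool → Bool → Carrier
  gapWeight false true  true = q + t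
  gapWeight true  false true = t
  gapWeight _     _     _    = 1#

  wordWeight : ∀ {n} → Bool → Vec Bool n → Vec Bool n → Carrier
  wordWeight a []      []      = 1#
  wordWeight a (b ∷ X) (k ∷ K) = gapWeight a b k * wordWeight b X K

  ribbon² : List Bool → ℕ → List Bool → ℕ → Fun² → Carrier
  ribbon² as c bs d φ = ribbon as c (λ α → ribbon bs d (φ α))

  -- The summand of the word A = a ∷ X, the run of its first letter a having pending size c.
  summand : ∀ {n} → Bool → ℕ → Vec Bool n → Vec Bool n → Fun² → Carrier
  summand a c X K φ = wordWeight a X K *
    ribbon² (joins (not a) (∁ X) K) (if a then 0 else c) (joins a X K) (if a then c else 0) φ

  -- After a cell of the other letter the pending block cannot grow: the next element of X, if any,
  -- has bit `false`. It may be emitted at once, leaving the empty block 0.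
  ribbon-joins-flush : ∀ {n} (X K : Vec Bool n) c ψ →
    ribbon (joins false X K) c ψ ≈ ribbon (joins false X K) 0 (λ α → ψ (block c ++ α))
  ribbon-joins-flush []          []      c ψ = refl
  ribbon-joins-flush (true  ∷ X) (k ∷ K) c ψ = refl
  ribbon-joins-flush (false ∷ X) (k ∷ K) c ψ = ribbon-joins-flush X K c ψ

  summand-cut : ∀ {n} a c (X K : Vec Bool n) φ → summand a c (a ∷ X) (false ∷ K) φ ≈ summand a 1 X K (put a c φ)
  summand-cut false c X K φ = *-congʳ (*-identityˡ _)
  summand-cut true  c X K φ = *-congʳ (*-identityˡ _)

  summand-join : ∀ {n} a c (X K : Vec Bool n) φ →
    summand a c (a ∷ X) (true ∷ K) φ ≈ q * summand a (suc c) X K φ + t * summand a 1 X K (put a c φ)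
  summand-join false c X K φ =
    solve 5 (λ q t w x y → (con 1 :* w) :* (q :* x :+ t :* y) := q :* (w :* x) :+ t :* (w :* y)) refl q t _ _ _
  -- The gap now belongs to the inner ribbon, so linearity of the outer one has to bring q and t
  -- outside.
  summand-join true c X K φ = trans (*-congˡ (trans (ribbon-+ (joins false (∁ X) K) 0 _ _)
      (+-cong (ribbon-* (joins false (∁ X) K) 0 q _) (ribbon-* (joins false (∁ X) K) 0 t _))))
    (solve 5 (λ q t w x y → (con 1 :* w) :* (q :* x :+ t :* y) := q :* (w :* x) :+ t :* (w :* y)) refl q t _ _ _)

  -- The pending block of `a` is flushed and the other factor opens a block of size 1, whether or
  -- not the gap lies in K; only the weight depends on k.
  summand-switch : ∀ {n} a c k (X K : Vec Bool n) φ →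
    summand a c (not a ∷ X) (k ∷ K) φ ≈ gapWeight a (not a) k * summand (not a) 1 X K (put a c φ)
  summand-switch false c k X K φ = trans (*-assoc _ _ _) (*-congˡ (*-congˡ (ribbon-joins-flush (∁ X) K c _)))
  summand-switch true  c k X K φ = trans (*-assoc _ _ _) (*-congˡ (*-congˡ
    (ribbon-cong (joins true (∁ X) K) 1 (λ α → ribbon-joins-flush X K c (φ α)))))

  mutual
    ∑-summand-join : ∀ {n} a c (K : Vec Bool n) φ → ∑ (allSubsets n) (λ X → summand a c (a ∷ X) (true ∷ K) φ) ≈
      q * words a (suc c) (toList K) φ + t * words a 1 (toList K) (put a c φ)
    ∑-summand-join {n} a c K φ = trans (∑-cong (allSubsets n) (λ X → summand-join a c X K φ))
      (trans (∑-+ (allSubsets n) _ _) (+-cong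
        (trans (∑-*ˡ (allSubsets n) q _) (*-congˡ (∑-summand a (suc c) K φ)))
        (trans (∑-*ˡ (allSubsets n) t _) (*-congˡ (∑-summand a 1 K _)))))

    ∑-summand-switch : ∀ {n} a c k (K : Vec Bool n) φ → ∑ (allSubsets n) (λ X → summand a c (not a ∷ X) (k ∷ K) φ) ≈
      gapWeight a (not a) k * words (not a) 1 (toList K) (put a c φ)
    ∑-summand-switch {n} a c k K φ = trans (∑-cong (allSubsets n) (λ X → summand-switch a c k X K φ))
      (trans (∑-*ˡ (allSubsets n) _ _) (*-congˡ (∑-summand (not a) 1 K _)))

    ∑-summand : ∀ {n} a c (K : Vec Bool n) φ → ∑ (allSubsets n) (λ X → summand a c X K φ) ≈ words a c (toList K) φ
    ∑-summand false c [] φ = trans (+-identityʳ _) (*-identityˡ _)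
    ∑-summand true  c [] φ = trans (+-identityʳ _) (*-identityˡ _)
    ∑-summand {suc n} false c (false ∷ K) φ = trans (∑-allSubsets n _) (+-cong
      (trans (∑-cong (allSubsets n) (λ X → summand-cut false c X K φ)) (∑-summand false 1 K _))
      (trans (∑-summand-switch false c false K φ) (*-identityˡ _)))
    ∑-summand {suc n} true c (false ∷ K) φ = trans (∑-allSubsets n _) (+-cong
      (trans (∑-summand-switch true c false K φ) (*-identityˡ _))
      (trans (∑-cong (allSubsets n) (λ X → summand-cut true c X K φ)) (∑-summand true 1 K _)))
    ∑-summand {suc n} false c (true ∷ K) φ = trans (∑-allSubsets n _) (trans (+-cong
      (∑-summand-join false c K φ) (∑-summand-switch false c true K φ))
      (+-assoc _ _ _))
    ∑-summand {suc n} true c (true ∷ K) φ = trans (∑-allSubsets n _) (trans (+-cong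
      (∑-summand-switch true c true K φ) (∑-summand-join true c K φ))
      (solve 3 (λ x y z → x :+ (y :+ z) := y :+ (x :+ z)) refl _ _ _))

-- The coefficients C^K_{I,J} and part (a)

module Coproduct {c ℓ : Level} (R : CommutativeRing c ℓ) (q t tinv : CommutativeRing.Carrier R)
  (t*tinv : CommutativeRing._≈_ R (CommutativeRing._*_ R t tinv) (CommutativeRing.1# R)) where
  open CommutativeRing R
  open NSym R
  open Eval R
  open Ribbon R q t
  open Words R q t
  open import Algebra.Solver.Ring.NaturalCoefficients.Default commutativeSemiring using (solve; _:=_; _:*_)

  weight : ℕ → ℕ → ℕ → ℕ → Carrier
  weight i j d e = pow tinv (i ℕ.+ j) * (pow (q + t) d * pow t e)

  weight-sucˡ : ∀ i j d e → weight (suc i) j d (suc e) ≈ weight i j d e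
  weight-sucˡ i j d e = trans
    (solve 5 (λ s t x y z → (s :* x) :* (y :* (t :* z)) := (t :* s) :* (x :* (y :* z))) refl tinv t _ _ _)
    (trans (*-congʳ t*tinv) (*-identityˡ _))

  weight-sucʳ : ∀ i j d e → weight i (suc j) d (suc e) ≈ weight i j d e
  weight-sucʳ i j d e = trans (reflexive (≡.cong (λ n → pow tinv n * (pow (q + t) d * pow t (suc e))) (NP.+-suc i j)))
    (weight-sucˡ i j d e)

  -- Each gap of K inside a run adds one factor t and, through |I| or |J|, one factor `tinv`; these
  -- cancel, and the ascents and descents in K remain.
  weight-≈ : ∀ {n} a (X K : Vec Bool n) →
    weight (trues (joins (not a) (∁ X) K)) (trues (joins a X K))
      ∣ K ∩ runEnds (not a) (∁ X) ∣ ∣ K ∩ ∁ (runEnds (not a) (∁ X)) ∣ ≈ wordWeight a X K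
  weight-≈ a []          []      = trans (*-identityˡ _) (*-identityˡ 1#)
  weight-≈ false (false ∷ X) (false ∷ K) = trans (weight-≈ false X K) (sym (*-identityˡ _))
  weight-≈ false (true  ∷ X) (false ∷ K) = trans (weight-≈ true  X K) (sym (*-identityˡ _))
  weight-≈ true  (false ∷ X) (false ∷ K) = trans (weight-≈ false X K) (sym (*-identityˡ _))
  weight-≈ true  (true  ∷ X) (false ∷ K) = trans (weight-≈ true  X K) (sym (*-identityˡ _))
  weight-≈ false (false ∷ X) (true  ∷ K) = trans
    (weight-sucˡ (trues (joins true (∁ X) K)) (trues (joins false X K))
      ∣ K ∩ runEnds (not false) (∁ X) ∣ ∣ K ∩ ∁ (runEnds (not false) (∁ X)) ∣) (trans (weight-≈ false X K) (sym (*-identityˡ _)))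
  weight-≈ true  (true  ∷ X) (true  ∷ K) = trans
    (weight-sucʳ (trues (joins false (∁ X) K)) (trues (joins true X K))
      ∣ K ∩ runEnds (not true) (∁ X) ∣ ∣ K ∩ ∁ (runEnds (not true) (∁ X)) ∣) (trans (weight-≈ true X K) (sym (*-identityˡ _)))
  weight-≈ false (true  ∷ X) (true  ∷ K) = trans
    (solve 4 (λ r x y z → x :* ((r :* y) :* z) := r :* (x :* (y :* z))) refl (q + t) _ _ _) (*-congˡ (weight-≈ true X K))
  weight-≈ true  (false ∷ X) (true  ∷ K) = trans
    (solve 4 (λ r x y z → x :* (y :* (r :* z)) := r :* (x :* (y :* z))) refl t _ _ _) (*-congˡ (weight-≈ false X K))

  term : ∀ {N} → List ℕ → Subset N → Carrier
  term L A = pow (q + t) (length (filterᵇ (λ x → x ∈ᵇ c₂ A) L)) * pow t (length (filterᵇ (λ x → not (x ∈ᵇ c₂ A)) L))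

  term-≈ : ∀ {n} a (X K : Vec Bool n) → term (elems K) (a ∷ X) ≈
    pow (q + t) ∣ K ∩ runEnds (not a) (∁ X) ∣ * pow t ∣ K ∩ ∁ (runEnds (not a) (∁ X)) ∣
  term-≈ a X K rewrite c₁-elems (not a) (∁ X) = reflexive (≡.cong₂ (λ d e → pow (q + t) d * pow t e)
    (length-filter-elemsFrom _ 1 K E (∈ᵇ-elems E))
    (length-filter-elemsFrom _ 1 K (∁ E) (λ i → ≡.trans (≡.cong not (∈ᵇ-elems E i)) (≡.sym (VP.lookup-map i not E)))))
    where E = runEnds (not a) (∁ X)

  sumR-∑ : ∀ {a} {X : Set a} (f : X → Carrier) xs → sumR (List.map f xs) ≈ ∑ xs f
  sumR-∑ f []       = refl
  sumR-∑ f (x ∷ xs) = +-congˡ (sumR-∑ f xs)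

  -- Ccoef with N in place of m + n, so that m + (k ∸ m) can be rewritten to k.
  coef : (N : ℕ) {m′ n′ : ℕ} → ℕ → List ℕ → Subset m′ → Subset n′ → Carrier
  coef N n L I J = pow tinv (∣ I ∣ ℕ.+ ∣ J ∣) * sumR (List.map (term L) (filterᵇ (λ A → compatible L A I J) (binom N n)))

  coef-∑ : ∀ N {m′ n′} n L (I : Subset m′) (J : Subset n′) → coef N n L I J ≈
    ∑ (allSubsets N) (λ A → if ∣ A ∣ ≡ᵇ n
      then pow tinv (∣ I ∣ ℕ.+ ∣ J ∣) * (if compatible L A I J then term L A else 0#) else 0#)
  coef-∑ N n L I J = trans (*-congˡ (trans (sumR-∑ (term L) (filterᵇ _ (binom N n))) (trans (∑-filterᵇ _ (binom N n) _)
    (∑-filterᵇ (λ A → ∣ A ∣ ≡ᵇ n) (allSubsets N) _)))) (trans (sym (∑-*ˡ (allSubsets N) _ _))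
    (∑-cong (allSubsets N) (λ A → sym (if-* (∣ A ∣ ≡ᵇ n) _ _))))

  -- Pending size 0 treats an empty tensor factor like the others: a leading `false` bit closes an
  -- empty block, which adds no part, and opens the first real one.
  ⟦Bset⟧-joins : ∀ {n} m p (X K : Vec Bool n) (I : Subset (pred m)) → m ≡ ∣ p ∷ X ∣ →
    toList I ≡ List.drop 1 (joinsFrom p X K) → ∀ ψ → ⟦ Bset q t m I ⟧ ψ ≈ ribbon (joinsFrom p X K) 0 ψ
  ⟦Bset⟧-joins zero p X K [] em eI ψ = trans (⟦Bset0⟧ ψ)
    (reflexive (≡.cong (λ l → ribbon l 0 ψ) (≡.sym (joins-empty false (p ∷ X) (false ∷ K) em))))
  ⟦Bset⟧-joins (suc m) p X K I em eI ψ = trans (⟦Bset⟧ m I ψ)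
    (reflexive (≡.trans (≡.cong (λ l → ribbon l 1 ψ) eI)
      (≡.cong (λ l → ribbon l 0 ψ) (≡.sym (joins-false (p ∷ X) (false ∷ K) em)))))

  wordTerm : ∀ {n} → Vec Bool n → Fun² → Subset (suc n) → Carrier
  wordTerm K φ (a ∷ X) = wordWeight a X K * ribbon² (joinsFrom (not a) (∁ X) K) 0 (joinsFrom a X K) 0 φ

  ∑-wordTerm : ∀ {n} (K : Vec Bool n) φ → ∑ (allSubsets (suc n)) (wordTerm K φ) ≈ start (toList K) φ
  ∑-wordTerm {n} K φ = trans (∑-allSubsets n (wordTerm K φ)) (+-cong (∑-summand false 1 K φ) (∑-summand true 1 K φ))

  ⟦B⊗B⟧ : ∀ m n → Subset (pred m) → Subset (pred n) → Fun² → Carrier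
  ⟦B⊗B⟧ m n I J φ = ⟦ Bset q t m I ⟧ (λ α → ⟦ Bset q t n J ⟧ (φ α))

  if-≢ : ∀ {b} {x : Carrier} → b ≢ true → (if b then x else 0#) ≈ 0#
  if-≢ {true}  h = contradiction ≡.refl h
  if-≢ {false} h = refl

  -- By `compatible⇔` only one pair I, J contributes, the one read off from the `joins` lists.
  ∑-compatible : ∀ {l} m n (K : Vec Bool l) φ (A : Subset (suc l)) → m ≡ ∣ ∁ A ∣ → n ≡ ∣ A ∣ →
    ∑ (allSubsets (pred m)) (λ I → ∑ (allSubsets (pred n)) (λ J →
      (pow tinv (∣ I ∣ ℕ.+ ∣ J ∣) * (if compatible (elems K) A I J then term (elems K) A else 0#)) * ⟦B⊗B⟧ m n I J φ))
    ≈ wordTerm K φ A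
  ∑-compatible {l} m n K φ A@(a ∷ X) em en = trans
    (∑-allSubsets-single I _ (λ I′ ne → ∑-zero (allSubsets (pred n)) (λ J′ →
      vanish (λ e → ne (toList-injective I′ I (≡.trans (proj₁ (to (comp⇔ I′ J′) e)) (≡.sym eI)))))))
    (trans (∑-allSubsets-single J _ (λ J′ ne →
      vanish (λ e → ne (toList-injective J′ J (≡.trans (proj₂ (to (comp⇔ I J′) e)) (≡.sym eJ))))))
    (*-cong (trans (*-cong (reflexive (≡.cong₂ (λ i j → pow tinv (i ℕ.+ j)) tI tJ))
       (trans (if-true (from (comp⇔ I J) (eI , eJ))) (term-≈ a X K))) (weight-≈ a X K))
      (trans (⟦Bset⟧-joins m (not a) (∁ X) K I em eI _)
        (ribbon-cong (joinsFrom (not a) (∁ X) K) 0 (λ α → ⟦Bset⟧-joins n a X K J en eJ (φ α))))))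
    where
    lI = joinsFrom (not a) (∁ X) K
    lJ = joinsFrom a X K
    len : ∀ p (Y : Vec Bool l) {m} → m ≡ ∣ p ∷ Y ∣ → length (List.drop 1 (joinsFrom p Y K)) ≡ pred m
    len p Y e = ≡.trans (LP.length-drop 1 (joinsFrom p Y K))
      (≡.cong pred (≡.trans (length-joins false (p ∷ Y) (false ∷ K)) (≡.sym e)))
    I = proj₁ (fromList′ (List.drop 1 lI) (len (not a) (∁ X) em))
    eI = proj₂ (fromList′ (List.drop 1 lI) (len (not a) (∁ X) em))
    J = proj₁ (fromList′ (List.drop 1 lJ) (len a X en))
    eJ = proj₂ (fromList′ (List.drop 1 lJ) (len a X en))
    tI : ∣ I ∣ ≡ trues (joins (not a) (∁ X) K)
    tI = ≡.trans (∣∣-toList I) (≡.trans (≡.cong trues eI) (trues-joinsFrom (not a) (∁ X) K))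
    tJ : ∣ J ∣ ≡ trues (joins a X K)
    tJ = ≡.trans (∣∣-toList J) (≡.trans (≡.cong trues eJ) (trues-joinsFrom a X K))
    comp⇔ : ∀ (I : Subset (pred m)) (J : Subset (pred n)) → _
    comp⇔ I J = compatible⇔ a X K I J (≡.cong pred em) (≡.cong pred en)
    vanish : ∀ {b r x y} → b ≢ true → (r * (if b then x else 0#)) * y ≈ 0#
    vanish ne = trans (*-congʳ (trans (*-congˡ (if-≢ ne)) (zeroʳ _))) (zeroˡ _)

  ≡ᵇ-false : ∀ {m n} → m ≢ n → (m ≡ᵇ n) ≡ false
  ≡ᵇ-false {m} {n} ne with m ≡ᵇ n | NP.≡ᵇ⇒≡ m n
  ... | true  | h = contradiction (h _) ne
  ... | false | h = ≡.refl

  ∑-coef : ∀ {l} N m n (K : Vec Bool l) φ → N ≡ suc l → n ℕ.+ m ≡ suc l →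
    ∑ (allSubsets (pred m)) (λ I → ∑ (allSubsets (pred n)) (λ J → coef N n (elems K) I J * ⟦B⊗B⟧ m n I J φ))
    ≈ ∑ (allSubsets (suc l)) (λ A → if ∣ A ∣ ≡ᵇ n then wordTerm K φ A else 0#)
  ∑-coef {l} N m n K φ ≡.refl e = trans
    (∑-cong (allSubsets (pred m)) (λ I → trans
      (∑-cong (allSubsets (pred n)) (λ J → trans (*-congʳ (coef-∑ (suc l) n (elems K) I J))
        (sym (∑-*ʳ (allSubsets (suc l)) _ _))))
      (∑-swap (allSubsets (pred n)) (allSubsets (suc l)) _)))
    (trans (∑-swap (allSubsets (pred m)) (allSubsets (suc l)) _) (∑-cong (allSubsets (suc l)) byWord))
    where
    byWord : ∀ A → ∑ (allSubsets (pred m)) (λ I → ∑ (allSubsets (pred n)) (λ J →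
      (if ∣ A ∣ ≡ᵇ n then pow tinv (∣ I ∣ ℕ.+ ∣ J ∣) * (if compatible (elems K) A I J then term (elems K) A else 0#) else 0#)
        * ⟦B⊗B⟧ m n I J φ)) ≈ (if ∣ A ∣ ≡ᵇ n then wordTerm K φ A else 0#)
    byWord A with ∣ A ∣ ≡ᵇ n | NP.≡ᵇ⇒≡ ∣ A ∣ n
    ... | false | _ = ∑-zero (allSubsets (pred m)) (λ I → ∑-zero (allSubsets (pred n)) (λ J → zeroˡ _))
    ... | true  | h = ∑-compatible m n K φ A
      (≡.trans (≡.trans (≡.sym (NP.m+n∸m≡n n m)) (≡.cong₂ _∸_ e (≡.sym (h _)))) (≡.sym (SP.∣∁p∣≡n∸∣p∣ A))) (≡.sym (h _))

  ⟦RHS⟧ : ∀ k (K : Subset (pred k)) φ → ⟦ RHS q t tinv k K ⟧ (λ (α , β) → φ α β) ≈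
    ∑ (upTo (suc k)) (λ m → ∑ (allSubsets (pred m)) (λ I → ∑ (allSubsets (pred (k ∸ m))) (λ J →
      coef (m ℕ.+ (k ∸ m)) (k ∸ m) (elems K) I J * ⟦B⊗B⟧ m (k ∸ m) I J φ)))
  ⟦RHS⟧ k K φ = trans (∑-concatMap sum₃ (upTo (suc k)) _) (∑-cong (upTo (suc k)) (λ m →
    trans (∑-concatMap (sum₂ m) (allSubsets (pred m)) _) (∑-cong (allSubsets (pred m)) (λ I →
    trans (∑-concatMap (sum₁ m I) (allSubsets (pred (k ∸ m))) _) (∑-cong (allSubsets (pred (k ∸ m))) (λ J →
    trans (⟦scale²⟧ _ (Bset q t m I ⊗ Bset q t (k ∸ m) J) _)
      (*-congˡ (⟦⊗⟧ (Bset q t m I) (Bset q t (k ∸ m) J) (λ (α , β) → φ α β)))))))))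
    where
    sum₁ : ∀ m → Subset (pred m) → Subset (pred (k ∸ m)) → NS²
    sum₁ m I J = scale² (coef (m ℕ.+ (k ∸ m)) (k ∸ m) (elems K) I J) (Bset q t m I ⊗ Bset q t (k ∸ m) J)
    sum₂ : ∀ m → Subset (pred m) → NS²
    sum₂ m I = concatMap (sum₁ m I) (allSubsets (pred (k ∸ m)))
    sum₃ : ℕ → NS²
    sum₃ m = concatMap (sum₂ m) (allSubsets (pred m))

  ⟦RHS⟧-start : ∀ l (K : Subset l) φ → ⟦ RHS q t tinv (suc l) K ⟧ (λ (α , β) → φ α β) ≈ start (toList K) φ
  ⟦RHS⟧-start l K φ = trans (⟦RHS⟧ (suc l) K φ) (trans
    (∑-upTo-cong (suc (suc l)) (λ { m (s≤s m≤) →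
      ∑-coef (m ℕ.+ (suc l ∸ m)) m (suc l ∸ m) K φ (NP.m+[n∸m]≡n m≤) (NP.m∸n+n≡m m≤) }))
    (trans (∑-swap (upTo (suc (suc l))) (allSubsets (suc l)) _) (trans (∑-cong (allSubsets (suc l)) (λ A →
      let A≤ = SP.∣p∣≤n A in
      -- Each word A occurs for one m only, the number of cells outside A.
      trans (∑-upTo-single (suc (suc l)) (suc l ∸ ∣ A ∣) (s≤s (NP.m∸n≤m (suc l) ∣ A ∣)) _
        (λ { m (s≤s m≤) ne → if-false (≡ᵇ-false {∣ A ∣} {suc l ∸ m} (λ e →
           ne (≡.trans (≡.sym (NP.m∸[m∸n]≡n m≤)) (≡.cong (suc l ∸_) (≡.sym e))))) }))
      (if-true (≡.trans (≡.cong (∣ A ∣ ≡ᵇ_) (NP.m∸[m∸n]≡n A≤)) (≡ᵇ-refl ∣ A ∣)))))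
    (∑-wordTerm K φ))))

  ⟦△Bset⟧ : ∀ l (K : Subset l) φ → ⟦ △ (Bset q t (suc l) K) ⟧ (λ (α , β) → φ α β) ≈ start (toList K) φ
  ⟦△Bset⟧ l K φ = trans (⟦△⟧ (Bset q t (suc l) K) (λ (α , β) → φ α β)) (trans (⟦Bset⟧ l K (λ α → ⟦△H⟧ α φ))
    (trans (ribbon-△H (toList K) 0 φ) (+-congˡ (+-identityʳ _))))

  ⟦△B⟧ : ∀ k (K : Subset (pred k)) φ → ⟦ △ (Bset q t k K) ⟧ φ ≈ ⟦ RHS q t tinv k K ⟧ φ
  -- Without a first cell there is no word `a ∷ X`; both sides are 1 ⊗ 1.
  ⟦△B⟧ zero [] φ = trans
    (trans (⟦△⟧ (Bset q t 0 []) φ) (trans (⟦Bset0⟧ (λ α → ⟦ △H α ⟧ φ)) (trans (+-identityʳ _) (*-identityˡ _))))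
    (sym (trans (⟦RHS⟧ 0 [] (λ α β → φ (α , β))) (trans (+-identityʳ _) (trans (+-identityʳ _) (trans (+-identityʳ _)
      (trans (*-cong (trans (*-identityˡ _) (trans (+-identityʳ _) (*-identityˡ 1#)))
        (trans (⟦Bset0⟧ (λ α → ⟦ Bset q t 0 [] ⟧ (λ β → φ (α , β)))) (⟦Bset0⟧ (λ β → φ ([] , β))))) (*-identityˡ _)))))))
  ⟦△B⟧ (suc l) K φ = trans (⟦△Bset⟧ l K (λ α β → φ (α , β))) (sym (⟦RHS⟧-start l K (λ α β → φ (α , β))))

theorem4p7 : ∀ {c ℓ : Level} (R : CommutativeRing c ℓ) →
    let open CommutativeRing R
        open NSym R
    in (q t tinv : Carrier) → t * tinv ≈ 1# →
       (∀ (k : ℕ) (K : Subset (pred k)) →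
          △ (Bset q t k K) ≋² RHS q t tinv k K)
       ×
       (∀ (α β : List ℕ) → IsComposition α → IsComposition β →
          (B q t α · B q t β) ≋ B q t (α ⊙ β))
theorem4p7 R q t tinv t*tinv =
  (λ k K → ≋²-from-⟦⟧ (△ (Bset q t k K)) (RHS q t tinv k K) (⟦△B⟧ k K)) ,
  (λ α β pα pβ → ≋-from-⟦⟧ (B q t α · B q t β) (B q t (α ⊙ β)) (⟦B·B⟧ α β pα pβ))
  where
  open NSym R
  open Eval R
  open Words R q t
  open Coproduct R q t tinv t*tinv
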